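{- There is an absolute constant $A>0$ such that the following holds. Let $T$ be a finite set of distinct positive integers with minimum element $N\ge3$. Let $\alpha=\prod_{n\in T}(1-1/n)$ be the common value of $\alpha(C)$ for $C\in\mathcal{C}(T)$. Then \[ \frac1{W(T)}\sum_{C\in\mathcal{C}(T)}|\delta(C)-\alpha|^2\le A\,\frac{\alpha^2\log N}{N^2}. \]
   Context: For a finite set $T$ of positive integers, $\mathcal{C}(T)$ is the set of all $C=\{(n,r(n)):n\in T\}$ with exactly one integer $r(n)$, $1\le r(n)\le n$, chosen for each $n\in T$; each pair $(n,r)$ is interpreted as the residue class $r\pmod n$. $W(T)=\#\mathcal{C}(T)=\prod_{n\in T}n$. For $C\in\mathcal{C}(T)$, $\delta(C)$ is the asymptotic density of the set of integers not congruent to $r\pmod n$ for any $(n,r)\in C$, and $\alpha(C)=\prod_{n\in T}(1-1/n)$. -}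

module Defs where

open import Data.Integer.Base as ℤ using (ℤ; +_; +[1+_])
import Data.Integer.Properties as ℤ
open import Data.Integer.Divisibility.Signed using (_∣_; _∣?_; ∣m+n∣m⇒∣n; ∣m∣n⇒∣m+n; ∣ᵤ⇒∣; ∣⇒∣ᵤ)
import Data.Integer.Solver as ℤSolver
open import Data.List.Base using (List; []; _∷_; map; length; filter; foldr; applyUpTo; cartesianProductWith)
open import Data.List.Properties
  using (length-filter; length-applyUpTo; length-++; length-map)
open import Data.List.Membership.Propositional using (_∈_)
open import Data.List.Relation.Unary.All as All using (All; []; _∷_)
open import Data.List.Relation.Unary.All.Properties using (map⁺)
open import Data.Nat.Base as ℕ using (ℕ; zero; suc)
open import Data.Nat.DivMod using (_/_; _%_; m≡m%n+[m/n]*n; m%n<n)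
import Data.Nat.Divisibility as ℕ
open import Data.Nat.ListAction using (product)
open import Data.Nat.ListAction.Properties using (product≢0)
import Data.Nat.Properties as ℕ
import Data.Nat.Solver as ℕSolver
open import Data.Product.Base using (∃; _×_; _,_; proj₁; proj₂)
open import Data.Rational.Base as ℚ using (ℚ; mkℚ; 0ℚ; 1ℚ; ½; ∣_∣; toℚᵘ)
import Data.Rational.Properties as ℚ
import Data.Rational.Solver as ℚSolver
open import Data.Rational.Unnormalised.Base as ℚᵘ using (mkℚᵘ)
import Data.Rational.Unnormalised.Properties as ℚᵘ
open import Data.Bool.Base using (if_then_else_; true; false)
open import Data.Sum.Base using (inj₁; inj₂)
open import Function.Base using (_∘_)
open import Relation.Binary.PropositionalEquality
  using (_≡_; refl; sym; trans; cong; cong₂; subst; subst₂; module ≡-Reasoning)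
open import Relation.Nullary using (Dec; does; yes; no; ¬_; ¬?; contradiction)
open import Relation.Binary.Definitions using (tri<; tri≈; tri>)
open import Relation.Unary using (Pred; Decidable)
open import Level using (0ℓ)

infix 9 _²

_² : ℚ → ℚ
p ² = p ℚ.* p

∑ : List ℚ → ℚ
∑ = foldr ℚ._+_ 0ℚ

∏ : List ℚ → ℚ
∏ = foldr ℚ._*_ 1ℚ

toℚᵘ-/ : ∀ i d .{{_ : ℕ.NonZero d}} → toℚᵘ (i ℚ./ d) ℚᵘ.≃ (i ℚᵘ./ d)
toℚᵘ-/ i (suc d) = ℚ.toℚᵘ-fromℚᵘ (mkℚᵘ i d)

frac-≤ : ∀ a m b n .{{_ : ℕ.NonZero m}} .{{_ : ℕ.NonZero n}} →
         a ℕ.* n ℕ.≤ b ℕ.* m → (+ a ℚ./ m) ℚ.≤ (+ b ℚ./ n)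
frac-≤ a m@(suc _) b n@(suc _) h = ℚ.toℚᵘ-cancel-≤
  (ℚᵘ.≤-respˡ-≃ (ℚᵘ.≃-sym {x = toℚᵘ (+ a ℚ./ m)} (toℚᵘ-/ (+ a) m))
  (ℚᵘ.≤-respʳ-≃ (ℚᵘ.≃-sym {x = toℚᵘ (+ b ℚ./ n)} (toℚᵘ-/ (+ b) n))
  (ℚᵘ.*≤* (subst₂ ℤ._≤_ (ℤ.pos-* a n) (ℤ.pos-* b m) (ℤ.+≤+ h)))))

frac-+ : ∀ a m b n .{{_ : ℕ.NonZero m}} .{{_ : ℕ.NonZero n}} →
         (+ a ℚ./ m) ℚ.+ (+ b ℚ./ n) ≡
         (+ (a ℕ.* n ℕ.+ b ℕ.* m) ℚ./ (m ℕ.* n)) {{ℕ.m*n≢0 m n}}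
frac-+ a m@(suc _) b n@(suc _) = ℚ.toℚᵘ-injective
  (ℚᵘ.≃-trans (ℚ.toℚᵘ-homo-+ (+ a ℚ./ m) (+ b ℚ./ n))
  (ℚᵘ.≃-trans (ℚᵘ.+-cong (toℚᵘ-/ (+ a) m) (toℚᵘ-/ (+ b) n))
  (ℚᵘ.≃-trans (ℚᵘ.≃-reflexive (cong (λ z → z ℚᵘ./ (m ℕ.* n)) numerators))
  (ℚᵘ.≃-sym {x = toℚᵘ (+ (a ℕ.* n ℕ.+ b ℕ.* m) ℚ./ (m ℕ.* n))}
    (toℚᵘ-/ (+ (a ℕ.* n ℕ.+ b ℕ.* m)) (m ℕ.* n))))))
  where
  numerators : + a ℤ.* + n ℤ.+ + b ℤ.* + m ≡ + (a ℕ.* n ℕ.+ b ℕ.* m)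
  numerators = cong₂ ℤ._+_ (sym (ℤ.pos-* a n)) (sym (ℤ.pos-* b m))

archimedean : ∀ a ε → 0ℚ ℚ.< ε →
              ∃ λ K → ∀ L .{{_ : ℕ.NonZero L}} → K ℕ.≤ L → (+ a ℚ./ L) ℚ.< ε
archimedean a (mkℚ (+ 0) d c) (ℚ.*<* (ℤ.+<+ 0<0)) = contradiction 0<0 (λ ())
archimedean a ε@(mkℚ +[1+ n ] d c) _ = suc (a ℕ.* suc d) , below
  where
  below : ∀ L .{{_ : ℕ.NonZero L}} → suc (a ℕ.* suc d) ℕ.≤ L → (+ a ℚ./ L) ℚ.< ε
  below L@(suc _) h = ℚ.toℚᵘ-cancel-<
    (ℚᵘ.<-respˡ-≃ (ℚᵘ.≃-sym {x = toℚᵘ (+ a ℚ./ L)} (toℚᵘ-/ (+ a) L))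
    (ℚᵘ.*<* (subst₂ ℤ._<_ (ℤ.pos-* a (suc d)) (ℤ.pos-* (suc n) L)
      (ℤ.+<+ (ℕ.≤-trans h (ℕ.m≤m+n L (n ℕ.* L)))))))
archimedean a (mkℚ ℤ.-[1+ n ] d c) (ℚ.*<* ())

private
  swap-neg : ∀ x y → ℚ.- (x ℚ.- y) ≡ y ℚ.- x
  swap-neg = solve 2 (λ x y → :- (x :- y) := y :- x) refl
    where open ℚSolver.+-*-Solver

  x≡y+[x-y] : ∀ x y → x ≡ y ℚ.+ (x ℚ.- y)
  x≡y+[x-y] = solve 2 (λ x y → x := y :+ (x :- y)) refl
    where open ℚSolver.+-*-Solver

  [y+e]-y≡e : ∀ y e → (y ℚ.+ e) ℚ.- y ≡ e
  [y+e]-y≡e = solve 2 (λ y e → (y :+ e) :- y := e) refl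
    where open ℚSolver.+-*-Solver

  through : ∀ z x y → x ℚ.- y ≡ (z ℚ.- y) ℚ.- (z ℚ.- x)
  through = solve 3 (λ z x y → x :- y := (z :- y) :- (z :- x)) refl
    where open ℚSolver.+-*-Solver

  product-difference : ∀ x y x′ y′ →
    x ℚ.* y ℚ.- x′ ℚ.* y′ ≡ x ℚ.* (y ℚ.- y′) ℚ.+ y′ ℚ.* (x ℚ.- x′)
  product-difference = solve 4 (λ x y x′ y′ →
    x :* y :- x′ :* y′ := x :* (y :- y′) :+ y′ :* (x :- x′)) refl
    where open ℚSolver.+-*-Solver

x≤y+e⇒x-y≤e : ∀ {x y e} → x ℚ.≤ y ℚ.+ e → x ℚ.- y ℚ.≤ e
x≤y+e⇒x-y≤e {x} {y} {e} h =
  subst (x ℚ.- y ℚ.≤_) ([y+e]-y≡e y e) (ℚ.+-monoˡ-≤ (ℚ.- y) h)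

∣x-y∣≤ : ∀ {x y e} → x ℚ.≤ y ℚ.+ e → y ℚ.≤ x ℚ.+ e → ∣ x ℚ.- y ∣ ℚ.≤ e
∣x-y∣≤ {x} {y} {e} h₁ h₂ with ℚ.∣p∣≡p∨∣p∣≡-p (x ℚ.- y)
... | inj₁ eq = subst (ℚ._≤ e) (sym eq) (x≤y+e⇒x-y≤e {x} h₁)
... | inj₂ eq = subst (ℚ._≤ e) (sym (trans eq (swap-neg x y))) (x≤y+e⇒x-y≤e {y} h₂)

x≤∣x∣ : ∀ x → x ℚ.≤ ∣ x ∣
x≤∣x∣ x with ℚ.≤-total 0ℚ x
... | inj₁ 0≤x = ℚ.≤-reflexive (sym (ℚ.0≤p⇒∣p∣≡p 0≤x))
... | inj₂ x≤0 = ℚ.≤-trans x≤0 (ℚ.0≤∣p∣ x)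

infix 4 _⟶_

_⟶_ : (ℕ → ℚ) → ℚ → Set
a ⟶ l = ∀ ε → 0ℚ ℚ.< ε → ∃ λ K → ∀ n → K ℕ.≤ n → ∣ a n ℚ.- l ∣ ℚ.< ε

halve : ∀ ε → 0ℚ ℚ.< ε → ∃ λ h → 0ℚ ℚ.< h × h ℚ.+ h ≡ ε
halve ε 0<ε = ½ ℚ.* ε , positive , sum
  where
  positive : 0ℚ ℚ.< ½ ℚ.* ε
  positive = ℚ.positive⁻¹ (½ ℚ.* ε) {{ℚ.pos*pos⇒pos ½ ε {{ℚ.positive 0<ε}}}}

  ½+½≡1 : ½ ℚ.+ ½ ≡ 1ℚ
  ½+½≡1 = refl

  sum : ½ ℚ.* ε ℚ.+ ½ ℚ.* ε ≡ ε
  sum = trans (sym (ℚ.*-distribʳ-+ ε ½ ½)) (trans (cong (ℚ._* ε) ½+½≡1) (ℚ.*-identityˡ ε))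

⟶-unique : ∀ {a l l′} → a ⟶ l → a ⟶ l′ → l ≡ l′
⟶-unique {a} {l} {l′} a⟶l a⟶l′ with ℚ.<-cmp 0ℚ ∣ l ℚ.- l′ ∣
... | tri< 0<ε _ _ = contradiction absurd (ℚ.<-irrefl refl)
  where
  absurd : ∣ l ℚ.- l′ ∣ ℚ.< ∣ l ℚ.- l′ ∣
  absurd =
    let h , 0<h , h+h≡ε = halve ∣ l ℚ.- l′ ∣ 0<ε
        K , close       = a⟶l h 0<h
        K′ , close′     = a⟶l′ h 0<h
        n               = K ℕ.⊔ K′
    in begin-strict
      ∣ l ℚ.- l′ ∣
        ≡⟨ cong ∣_∣ (through (a n) l l′) ⟩
      ∣ (a n ℚ.- l′) ℚ.- (a n ℚ.- l) ∣
        ≤⟨ ℚ.∣p-q∣≤∣p∣+∣q∣ (a n ℚ.- l′) (a n ℚ.- l) ⟩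
      ∣ a n ℚ.- l′ ∣ ℚ.+ ∣ a n ℚ.- l ∣
        <⟨ ℚ.+-mono-< (close′ n (ℕ.m≤n⊔m K K′)) (close n (ℕ.m≤m⊔n K K′)) ⟩
      h ℚ.+ h
        ≡⟨ h+h≡ε ⟩
      ∣ l ℚ.- l′ ∣ ∎
    where open ℚ.≤-Reasoning
... | tri≈ _ 0≡ε _ = trans (x≡y+[x-y] l l′)
  (trans (cong (l′ ℚ.+_) (ℚ.∣p∣≡0⇒p≡0 (l ℚ.- l′) (sym 0≡ε))) (ℚ.+-identityʳ l′))
... | tri> ¬0<ε ¬0≡ε ε<0 = contradiction (ℚ.≤-<-trans (ℚ.0≤∣p∣ (l ℚ.- l′)) ε<0) (ℚ.<-irrefl refl)

Cauchy : (ℕ → ℚ) → Set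
Cauchy a = ∀ ε → 0ℚ ℚ.< ε →
  ∃ λ K → ∀ m n → K ℕ.≤ m → K ℕ.≤ n → ∣ a m ℚ.- a n ∣ ℚ.< ε

record ℝ : Set where
  constructor mkℝ
  field
    approx : ℕ → ℚ
    cauchy : Cauchy approx

open ℝ public

infix 4 _≤ᴿ_ _<ᴿ_

_≤ᴿ_ : ℝ → ℝ → Set
x ≤ᴿ y = ∀ ε → 0ℚ ℚ.< ε →
  ∃ λ K → ∀ n → K ℕ.≤ n → approx x n ℚ.≤ approx y n ℚ.+ ε

_<ᴿ_ : ℝ → ℝ → Set
x <ᴿ y = ∃ λ ε → 0ℚ ℚ.< ε ×
  ∃ λ K → ∀ n → K ℕ.≤ n → approx x n ℚ.+ ε ℚ.≤ approx y n

fromℚ : ℚ → ℝ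
fromℚ q = mkℝ (λ _ → q)
  λ ε 0<ε → 0 , λ _ _ _ _ → subst (λ z → ∣ z ∣ ℚ.< ε) (sym (ℚ.+-inverseʳ q)) 0<ε

0ᴿ : ℝ
0ᴿ = fromℚ 0ℚ

cauchy-bounded : ∀ {a} → Cauchy a →
  ∃ λ B → ℚ.Positive B × ∃ λ K → ∀ n → K ℕ.≤ n → ∣ a n ∣ ℚ.≤ B
cauchy-bounded {a} ca with ca 1ℚ (ℚ.positive⁻¹ 1ℚ)
... | K , close =
  ∣ a K ∣ ℚ.+ 1ℚ ,
  ℚ.nonNeg+pos⇒pos ∣ a K ∣ {{ℚ.∣-∣-nonNeg (a K)}} 1ℚ ,
  K , λ n K≤n → begin
    ∣ a n ∣                       ≡⟨ cong ∣_∣ (x≡y+[x-y] (a n) (a K)) ⟩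
    ∣ a K ℚ.+ (a n ℚ.- a K) ∣     ≤⟨ ℚ.∣p+q∣≤∣p∣+∣q∣ (a K) (a n ℚ.- a K) ⟩
    ∣ a K ∣ ℚ.+ ∣ a n ℚ.- a K ∣   ≤⟨ ℚ.+-monoʳ-≤ ∣ a K ∣ (ℚ.<⇒≤ (close n K K≤n ℕ.≤-refl)) ⟩
    ∣ a K ∣ ℚ.+ 1ℚ                ∎
  where open ℚ.≤-Reasoning

shrink : ∀ h C → 0ℚ ℚ.< h → ℚ.Positive C → ∃ λ e → 0ℚ ℚ.< e × C ℚ.* e ≡ h
shrink h C 0<h C>0 = h ℚ.* ℚ.1/ C , positive , cancel
  where
  instance
    _ = ℚ.pos⇒nonZero C {{C>0}}

  positive : 0ℚ ℚ.< h ℚ.* ℚ.1/ C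
  positive = ℚ.positive⁻¹ (h ℚ.* ℚ.1/ C)
    {{ℚ.pos*pos⇒pos h {{ℚ.positive 0<h}} (ℚ.1/ C) {{ℚ.1/pos⇒pos C {{C>0}}}}}}

  cancel : C ℚ.* (h ℚ.* ℚ.1/ C) ≡ h
  cancel = begin
    C ℚ.* (h ℚ.* ℚ.1/ C)   ≡⟨ ℚ.*-assoc C h (ℚ.1/ C) ⟨
    (C ℚ.* h) ℚ.* ℚ.1/ C   ≡⟨ cong (ℚ._* ℚ.1/ C) (ℚ.*-comm C h) ⟩
    (h ℚ.* C) ℚ.* ℚ.1/ C   ≡⟨ ℚ.*-assoc h C (ℚ.1/ C) ⟩
    h ℚ.* (C ℚ.* ℚ.1/ C)   ≡⟨ cong (h ℚ.*_) (ℚ.*-inverseʳ C) ⟩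
    h ℚ.* 1ℚ               ≡⟨ ℚ.*-identityʳ h ⟩
    h                      ∎
    where open ≡-Reasoning

∣x*y∣<C*e : ∀ {C x y e} → ℚ.Positive C → ∣ x ∣ ℚ.≤ C → ∣ y ∣ ℚ.< e → ∣ x ℚ.* y ∣ ℚ.< C ℚ.* e
∣x*y∣<C*e {C} {x} {y} {e} C>0 x≤C y<e = begin-strict
  ∣ x ℚ.* y ∣       ≡⟨ ℚ.∣p*q∣≡∣p∣*∣q∣ x y ⟩
  ∣ x ∣ ℚ.* ∣ y ∣   ≤⟨ ℚ.*-monoʳ-≤-nonNeg ∣ y ∣ {{ℚ.∣-∣-nonNeg y}} x≤C ⟩
  C ℚ.* ∣ y ∣       <⟨ ℚ.*-monoʳ-<-pos C {{C>0}} y<e ⟩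
  C ℚ.* e           ∎
  where open ℚ.≤-Reasoning

product-close : ∀ {x y x′ y′ A B h ε εᵃ εᵇ} → ℚ.Positive A → ℚ.Positive B →
  A ℚ.* εᵇ ≡ h → B ℚ.* εᵃ ≡ h → h ℚ.+ h ≡ ε →
  ∣ x ∣ ℚ.≤ A → ∣ y′ ∣ ℚ.≤ B → ∣ x ℚ.- x′ ∣ ℚ.< εᵃ → ∣ y ℚ.- y′ ∣ ℚ.< εᵇ →
  ∣ x ℚ.* y ℚ.- x′ ℚ.* y′ ∣ ℚ.< ε
product-close {x} {y} {x′} {y′} {A} {B} {h} {ε} {εᵃ} {εᵇ}
  A>0 B>0 A*εᵇ≡h B*εᵃ≡h h+h≡ε x≤A y′≤B x-x′<εᵃ y-y′<εᵇ = begin-strict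
    ∣ x ℚ.* y ℚ.- x′ ℚ.* y′ ∣
      ≡⟨ cong ∣_∣ (product-difference x y x′ y′) ⟩
    ∣ x ℚ.* (y ℚ.- y′) ℚ.+ y′ ℚ.* (x ℚ.- x′) ∣
      ≤⟨ ℚ.∣p+q∣≤∣p∣+∣q∣ (x ℚ.* (y ℚ.- y′)) (y′ ℚ.* (x ℚ.- x′)) ⟩
    ∣ x ℚ.* (y ℚ.- y′) ∣ ℚ.+ ∣ y′ ℚ.* (x ℚ.- x′) ∣
      <⟨ ℚ.+-mono-<
           (∣x*y∣<C*e {A} {x} {y ℚ.- y′} {εᵇ} A>0 x≤A y-y′<εᵇ)
           (∣x*y∣<C*e {B} {y′} {x ℚ.- x′} {εᵃ} B>0 y′≤B x-x′<εᵃ) ⟩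
    A ℚ.* εᵇ ℚ.+ B ℚ.* εᵃ
      ≡⟨ cong₂ ℚ._+_ A*εᵇ≡h B*εᵃ≡h ⟩
    h ℚ.+ h
      ≡⟨ h+h≡ε ⟩
    ε ∎
    where open ℚ.≤-Reasoning

*-cauchy : ∀ {a b} → Cauchy a → Cauchy b → Cauchy (λ n → a n ℚ.* b n)
*-cauchy {a} {b} ca cb ε 0<ε =
  let A , A>0 , K₁ , a≤A = cauchy-bounded {a} ca
      B , B>0 , K₂ , b≤B = cauchy-bounded {b} cb
      h , 0<h , h+h≡ε = halve ε 0<ε
      εᵃ , 0<εᵃ , B*εᵃ≡h = shrink h B 0<h B>0
      εᵇ , 0<εᵇ , A*εᵇ≡h = shrink h A 0<h A>0
      K₃ , closeᵃ = ca εᵃ 0<εᵃ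
      K₄ , closeᵇ = cb εᵇ 0<εᵇ
      K₁₂ = K₁ ℕ.⊔ K₂
      K₃₄ = K₃ ℕ.⊔ K₄
  in K₁₂ ℕ.⊔ K₃₄ , λ m n K≤m K≤n →
    let K₁₂≤m = ℕ.m⊔n≤o⇒m≤o K₁₂ K₃₄ K≤m
        K₃₄≤m = ℕ.m⊔n≤o⇒n≤o K₁₂ K₃₄ K≤m
        K₁₂≤n = ℕ.m⊔n≤o⇒m≤o K₁₂ K₃₄ K≤n
        K₃₄≤n = ℕ.m⊔n≤o⇒n≤o K₁₂ K₃₄ K≤n
    in product-close {a m} {b m} {a n} {b n} {A} {B} {h} {ε} {εᵃ} {εᵇ}
         A>0 B>0 A*εᵇ≡h B*εᵃ≡h h+h≡ε
         (a≤A m (ℕ.m⊔n≤o⇒m≤o K₁ K₂ K₁₂≤m))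
         (b≤B n (ℕ.m⊔n≤o⇒n≤o K₁ K₂ K₁₂≤n))
         (closeᵃ m n (ℕ.m⊔n≤o⇒m≤o K₃ K₄ K₃₄≤m) (ℕ.m⊔n≤o⇒m≤o K₃ K₄ K₃₄≤n))
         (closeᵇ m n (ℕ.m⊔n≤o⇒n≤o K₃ K₄ K₃₄≤m) (ℕ.m⊔n≤o⇒n≤o K₃ K₄ K₃₄≤n))

infixl 7 _*ᴿ_

_*ᴿ_ : ℝ → ℝ → ℝ
x *ᴿ y = mkℝ (λ n → approx x n ℚ.* approx y n) (*-cauchy {approx x} {approx y} (cauchy x) (cauchy y))

record ℕ⁺ : Set where
  constructor mkℕ⁺
  field
    value       : ℕ
    {{nonZero}} : ℕ.NonZero value

open ℕ⁺ public using (value) renaming (nonZero to value≢0)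

value-injective : ∀ {m n} → value m ≡ value n → m ≡ n
value-injective {mkℕ⁺ (suc m)} {mkℕ⁺ (suc m)} refl = refl

recip : ℕ⁺ → ℚ
recip n = (+ 1 ℚ./ value n) {{value≢0 n}}

-- 1/(a+1) + … + 1/(a+m)
recipSum : ℕ → ℕ → ℚ
recipSum a zero    = 0ℚ
recipSum a (suc m) = (+ 1 ℚ./ suc a) ℚ.+ recipSum (suc a) m

recipSum-+ : ∀ a m n → recipSum a (m ℕ.+ n) ≡ recipSum a m ℚ.+ recipSum (a ℕ.+ m) n
recipSum-+ a zero    n = trans (cong (λ z → recipSum z n) (sym (ℕ.+-identityʳ a)))
                               (sym (ℚ.+-identityˡ (recipSum (a ℕ.+ 0) n)))
recipSum-+ a (suc m) n = begin
  r ℚ.+ recipSum (suc a) (m ℕ.+ n)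
    ≡⟨ cong (r ℚ.+_) (recipSum-+ (suc a) m n) ⟩
  r ℚ.+ (recipSum (suc a) m ℚ.+ recipSum (suc a ℕ.+ m) n)
    ≡⟨ ℚ.+-assoc r (recipSum (suc a) m) (recipSum (suc a ℕ.+ m) n) ⟨
  (r ℚ.+ recipSum (suc a) m) ℚ.+ recipSum (suc a ℕ.+ m) n
    ≡⟨ cong (λ z → (r ℚ.+ recipSum (suc a) m) ℚ.+ recipSum z n) (sym (ℕ.+-suc a m)) ⟩
  (r ℚ.+ recipSum (suc a) m) ℚ.+ recipSum (a ℕ.+ suc m) n ∎
  where
  open ≡-Reasoning
  r = + 1 ℚ./ suc a

private
  sum-fractions : ∀ m D .{{_ : ℕ.NonZero D}} →
                  (+ 1 ℚ./ D) ℚ.+ (+ m ℚ./ D) ≡ + suc m ℚ./ D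
  sum-fractions m D = trans (frac-+ 1 D m D)
    (ℚ.≤-antisym (frac-≤ (1 ℕ.* D ℕ.+ m ℕ.* D) (D ℕ.* D) (suc m) D (ℕ.≤-reflexive eq))
                 (frac-≤ (suc m) D (1 ℕ.* D ℕ.+ m ℕ.* D) (D ℕ.* D) (ℕ.≤-reflexive (sym eq))))
    where
    instance _ = ℕ.m*n≢0 D D

    eq : (1 ℕ.* D ℕ.+ m ℕ.* D) ℕ.* D ≡ suc m ℕ.* (D ℕ.* D)
    eq = solve 2 (λ m d → (con 1 :* d :+ m :* d) :* d := (con 1 :+ m) :* (d :* d)) refl m D
      where open ℕSolver.+-*-Solver

0≤recipSum : ∀ a m → 0ℚ ℚ.≤ recipSum a m
0≤recipSum a zero    = ℚ.≤-refl
0≤recipSum a (suc m) = ℚ.+-mono-≤ {0ℚ} {+ 1 ℚ./ suc a} {0ℚ} {recipSum (suc a) m}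
  (frac-≤ 0 1 1 (suc a) ℕ.z≤n) (0≤recipSum (suc a) m)

recipSum-lower : ∀ b m D .{{_ : ℕ.NonZero D}} → b ℕ.+ m ℕ.≤ D →
                 (+ m ℚ./ D) ℚ.≤ recipSum b m
recipSum-lower b zero    D h = ℚ.≤-reflexive (ℚ.0/n≡0 D)
recipSum-lower b (suc m) D h = subst (ℚ._≤ recipSum b (suc m)) (sum-fractions m D)
  (ℚ.+-mono-≤ {+ 1 ℚ./ D} {+ 1 ℚ./ suc b} {+ m ℚ./ D} {recipSum (suc b) m}
    (frac-≤ 1 D 1 (suc b) (ℕ.*-monoʳ-≤ 1 (ℕ.≤-trans (ℕ.m≤m+n (suc b) m) h′)))
    (recipSum-lower (suc b) m D h′))
  where
  h′ : suc b ℕ.+ m ℕ.≤ D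
  h′ = subst (ℕ._≤ D) (ℕ.+-suc b m) h

recipSum-upper : ∀ b m D .{{_ : ℕ.NonZero D}} → D ℕ.≤ suc b →
                 recipSum b m ℚ.≤ (+ m ℚ./ D)
recipSum-upper b zero    D h = ℚ.≤-reflexive (sym (ℚ.0/n≡0 D))
recipSum-upper b (suc m) D h = subst (recipSum b (suc m) ℚ.≤_) (sum-fractions m D)
  (ℚ.+-mono-≤ {+ 1 ℚ./ suc b} {+ 1 ℚ./ D} {recipSum (suc b) m} {+ m ℚ./ D}
    (frac-≤ 1 (suc b) 1 D (ℕ.*-monoʳ-≤ 1 h))
    (recipSum-upper (suc b) m D (ℕ.m≤n⇒m≤1+n h)))

recipSum-refine-≥ : ∀ a m k → recipSum a m ℚ.≤ recipSum (a ℕ.* suc k) (m ℕ.* suc k)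
recipSum-refine-≥ a zero    k = ℚ.≤-refl
recipSum-refine-≥ a (suc m) k = begin
  (+ 1 ℚ./ suc a) ℚ.+ recipSum (suc a) m
    ≤⟨ ℚ.+-mono-≤ {+ 1 ℚ./ suc a} {recipSum (a ℕ.* K) K} {recipSum (suc a) m} {recipSum (suc a ℕ.* K) (m ℕ.* K)}
         block (recipSum-refine-≥ (suc a) m k) ⟩
  recipSum (a ℕ.* K) K ℚ.+ recipSum (suc a ℕ.* K) (m ℕ.* K)
    ≡⟨ cong (λ z → recipSum (a ℕ.* K) K ℚ.+ recipSum z (m ℕ.* K)) (ℕ.+-comm K (a ℕ.* K)) ⟩
  recipSum (a ℕ.* K) K ℚ.+ recipSum (a ℕ.* K ℕ.+ K) (m ℕ.* K)
    ≡⟨ recipSum-+ (a ℕ.* K) K (m ℕ.* K) ⟨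
  recipSum (a ℕ.* K) (suc m ℕ.* K) ∎
  where
  open ℚ.≤-Reasoning
  K = suc k

  block : (+ 1 ℚ./ suc a) ℚ.≤ recipSum (a ℕ.* K) K
  block = ℚ.≤-trans
    (frac-≤ 1 (suc a) K (suc a ℕ.* K)
      (ℕ.≤-reflexive (trans (ℕ.*-identityˡ (suc a ℕ.* K)) (ℕ.*-comm (suc a) K))))
    (recipSum-lower (a ℕ.* K) K (suc a ℕ.* K) (ℕ.≤-reflexive (ℕ.+-comm (a ℕ.* K) K)))

recipSum-refine-≤ : ∀ a m k → recipSum (suc a ℕ.* suc k) (m ℕ.* suc k) ℚ.≤ recipSum a m
recipSum-refine-≤ a zero    k = ℚ.≤-refl
recipSum-refine-≤ a (suc m) k = begin
  recipSum (suc a ℕ.* K) (suc m ℕ.* K)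
    ≡⟨ recipSum-+ (suc a ℕ.* K) K (m ℕ.* K) ⟩
  recipSum (suc a ℕ.* K) K ℚ.+ recipSum (suc a ℕ.* K ℕ.+ K) (m ℕ.* K)
    ≡⟨ cong (λ z → recipSum (suc a ℕ.* K) K ℚ.+ recipSum z (m ℕ.* K)) (ℕ.+-comm (suc a ℕ.* K) K) ⟩
  recipSum (suc a ℕ.* K) K ℚ.+ recipSum (suc (suc a) ℕ.* K) (m ℕ.* K)
    ≤⟨ ℚ.+-mono-≤ {recipSum (suc a ℕ.* K) K} {+ 1 ℚ./ suc a} {recipSum (suc (suc a) ℕ.* K) (m ℕ.* K)} {recipSum (suc a) m}
         block (recipSum-refine-≤ (suc a) m k) ⟩
  (+ 1 ℚ./ suc a) ℚ.+ recipSum (suc a) m ∎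
  where
  open ℚ.≤-Reasoning
  K = suc k

  block : recipSum (suc a ℕ.* K) K ℚ.≤ (+ 1 ℚ./ suc a)
  block = ℚ.≤-trans
    (recipSum-upper (suc a ℕ.* K) K (suc a ℕ.* K) (ℕ.n≤1+n _))
    (frac-≤ K (suc a ℕ.* K) 1 (suc a)
      (ℕ.≤-reflexive (trans (ℕ.*-comm K (suc a)) (sym (ℕ.*-identityˡ (suc a ℕ.* K))))))

-- Right-endpoint Riemann sum of ∫₁ⁿ dt/t over intervals of length 1/(k+1):
-- ∑_{1≤j≤(n-1)(k+1)} 1/(k+1) · 1/(1 + j/(k+1)).
logSum : ℕ⁺ → ℕ → ℚ
logSum n k = recipSum (suc k) ((value n ℕ.∸ 1) ℕ.* suc k)

logSum-close : ∀ n k l → logSum n k ℚ.≤ logSum n l ℚ.+ (+ 1 ℚ./ suc l)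
logSum-close n k l = begin
  recipSum (suc k) (p ℕ.* suc k)
    ≤⟨ recipSum-refine-≥ (suc k) (p ℕ.* suc k) l ⟩
  recipSum (suc k ℕ.* suc l) (p ℕ.* suc k ℕ.* suc l)
    ≡⟨ cong₂ recipSum (ℕ.*-comm (suc k) (suc l)) swap ⟩
  recipSum (suc l ℕ.* suc k) (p ℕ.* suc l ℕ.* suc k)
    ≤⟨ recipSum-refine-≤ l (p ℕ.* suc l) k ⟩
  recipSum l (p ℕ.* suc l)
    ≡⟨ ℚ.+-identityʳ (recipSum l (p ℕ.* suc l)) ⟨
  recipSum l (p ℕ.* suc l) ℚ.+ 0ℚ
    ≤⟨ ℚ.+-monoʳ-≤ (recipSum l (p ℕ.* suc l)) (0≤recipSum (l ℕ.+ p ℕ.* suc l) 1) ⟩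
  recipSum l (p ℕ.* suc l) ℚ.+ recipSum (l ℕ.+ p ℕ.* suc l) 1
    ≡⟨ recipSum-+ l (p ℕ.* suc l) 1 ⟨
  recipSum l (p ℕ.* suc l ℕ.+ 1)
    ≡⟨ cong (recipSum l) (ℕ.+-comm (p ℕ.* suc l) 1) ⟩
  (+ 1 ℚ./ suc l) ℚ.+ recipSum (suc l) (p ℕ.* suc l)
    ≡⟨ ℚ.+-comm (+ 1 ℚ./ suc l) (recipSum (suc l) (p ℕ.* suc l)) ⟩
  recipSum (suc l) (p ℕ.* suc l) ℚ.+ (+ 1 ℚ./ suc l) ∎
  where
  open ℚ.≤-Reasoning
  p = value n ℕ.∸ 1

  swap : p ℕ.* suc k ℕ.* suc l ≡ p ℕ.* suc l ℕ.* suc k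
  swap = trans (ℕ.*-assoc p (suc k) (suc l))
    (trans (cong (p ℕ.*_) (ℕ.*-comm (suc k) (suc l))) (sym (ℕ.*-assoc p (suc l) (suc k))))

logSum-cauchy : ∀ n → Cauchy (logSum n)
logSum-cauchy n ε 0<ε =
  let K , below = archimedean 1 ε 0<ε
  in K , λ k l K≤k K≤l → ℚ.≤-<-trans
       (∣x-y∣≤ {logSum n k} {logSum n l} {+ 1 ℚ./ suc K}
         (enlarge k l K K≤l) (enlarge l k K K≤k))
       (below (suc K) (ℕ.n≤1+n K))
  where
  enlarge : ∀ k l K → K ℕ.≤ l → logSum n k ℚ.≤ logSum n l ℚ.+ (+ 1 ℚ./ suc K)
  enlarge k l K K≤l = ℚ.≤-trans (logSum-close n k l)
    (ℚ.+-monoʳ-≤ (logSum n l) (frac-≤ 1 (suc l) 1 (suc K) (ℕ.*-monoʳ-≤ 1 (ℕ.s≤s K≤l))))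

log : ℕ⁺ → ℝ
log n = mkℝ (logSum n) (logSum-cauchy n)

symmetricRange : ℕ → List ℤ
symmetricRange X = applyUpTo (λ i → + i ℤ.- + X) (suc (2 ℕ.* X))

module _ {S : Pred ℤ 0ℓ} (S? : Decidable S) where

  count : List ℤ → ℕ
  count ms = length (filter S? ms)

  HasDensity : ℚ → Set
  HasDensity d = (λ X → + count (symmetricRange X) ℚ./ suc (2 ℕ.* X)) ⟶ d

  private
    ind : ∀ {m} → Dec (S m) → ℕ
    ind d = if does d then 1 else 0

    ind-cong : ∀ {m n} (d : Dec (S m)) (e : Dec (S n)) → (S m → S n) → (S n → S m) →
               ind d ≡ ind e
    ind-cong (yes s) (yes t) f g = refl
    ind-cong (yes s) (no ¬t) f g = contradiction (f s) ¬t
    ind-cong (no ¬s) (yes t) f g = contradiction (g t) ¬s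
    ind-cong (no ¬s) (no ¬t) f g = refl

  countUpTo : (ℕ → ℤ) → ℕ → ℕ
  countUpTo f n = count (applyUpTo f n)

  private
    count-∷ : ∀ m ms → count (m ∷ ms) ≡ ind (S? m) ℕ.+ count ms
    count-∷ m ms with does (S? m)
    ... | true  = refl
    ... | false = refl

  countUpTo-≤ : ∀ f n → countUpTo f n ℕ.≤ n
  countUpTo-≤ f n =
    subst (countUpTo f n ℕ.≤_) (length-applyUpTo f n) (length-filter S? (applyUpTo f n))

  countUpTo-+ : ∀ f m n →
    countUpTo f (m ℕ.+ n) ≡ countUpTo f m ℕ.+ countUpTo (λ i → f (m ℕ.+ i)) n
  countUpTo-+ f zero    n = refl
  countUpTo-+ f (suc m) n
    rewrite count-∷ (f 0) (applyUpTo (f ∘ suc) (m ℕ.+ n))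
          | count-∷ (f 0) (applyUpTo (f ∘ suc) m)
          | countUpTo-+ (f ∘ suc) m n
    = sym (ℕ.+-assoc (ind (S? (f 0))) _ _)

  countUpTo-cong : ∀ f g → (∀ i → S (f i) → S (g i)) → (∀ i → S (g i) → S (f i)) →
                   ∀ n → countUpTo f n ≡ countUpTo g n
  countUpTo-cong f g to from zero    = refl
  countUpTo-cong f g to from (suc n)
    rewrite count-∷ (f 0) (applyUpTo (f ∘ suc) n)
          | count-∷ (g 0) (applyUpTo (g ∘ suc) n)
    = cong₂ ℕ._+_ (ind-cong (S? (f 0)) (S? (g 0)) (to 0) (from 0))
        (countUpTo-cong (f ∘ suc) (g ∘ suc) (to ∘ suc) (from ∘ suc) n)

  module Periodic (P : ℕ) {{P≢0 : ℕ.NonZero P}}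
    (up   : ∀ m → S m → S (m ℤ.+ + P))
    (down : ∀ m → S (m ℤ.+ + P) → S m) where

    window : ℕ → ℕ → ℤ
    window X i = + i ℤ.- + X

    window-+P : ∀ X i → window X (P ℕ.+ i) ≡ window X i ℤ.+ + P
    window-+P X i = trans (cong (ℤ._- + X) (ℤ.pos-+ P i))
      (solve 3 (λ p i x → (p :+ i) :- x := (i :- x) :+ p) refl (+ P) (+ i) (+ X))
      where open ℤSolver.+-*-Solver

    shift-up : ∀ X i → S (window X i) → S (window X (P ℕ.+ i))
    shift-up X i s = subst S (sym (window-+P X i)) (up _ s)

    shift-down : ∀ X i → S (window X (P ℕ.+ i)) → S (window X i)
    shift-down X i s = down _ (subst S (window-+P X i) s)

    countPeriod : ℕ
    countPeriod = countUpTo +_ P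

    window-suc : ∀ X i → window (suc X) (suc i) ≡ window X i
    window-suc X i = trans (cong₂ ℤ._-_ (ℤ.pos-+ 1 i) (ℤ.pos-+ 1 X))
      (solve 2 (λ i x → (con (+ 1) :+ i) :- (con (+ 1) :+ x) := i :- x) refl (+ i) (+ X))
      where open ℤSolver.+-*-Solver

    countUpTo-rotate : ∀ X → countUpTo (window X ∘ suc) P ≡ countUpTo (window X) P
    countUpTo-rotate X = ℕ.+-cancelˡ-≡ (ind (S? (window X 0))) _ _ (begin
      ind (S? (window X 0)) ℕ.+ countUpTo (window X ∘ suc) P
        ≡⟨ count-∷ (window X 0) (applyUpTo (window X ∘ suc) P) ⟨
      countUpTo (window X) (suc P)
        ≡⟨ cong (countUpTo (window X)) (ℕ.+-comm 1 P) ⟩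
      countUpTo (window X) (P ℕ.+ 1)
        ≡⟨ countUpTo-+ (window X) P 1 ⟩
      countUpTo (window X) P ℕ.+ countUpTo (λ i → window X (P ℕ.+ i)) 1
        ≡⟨ cong (countUpTo (window X) P ℕ.+_)
             (countUpTo-cong (λ i → window X (P ℕ.+ i)) (window X) (shift-down X) (shift-up X) 1) ⟩
      countUpTo (window X) P ℕ.+ countUpTo (window X) 1
        ≡⟨ cong (countUpTo (window X) P ℕ.+_)
             (trans (count-∷ (window X 0) []) (ℕ.+-identityʳ _)) ⟩
      countUpTo (window X) P ℕ.+ ind (S? (window X 0))
        ≡⟨ ℕ.+-comm (countUpTo (window X) P) _ ⟩
      ind (S? (window X 0)) ℕ.+ countUpTo (window X) P ∎)
      where open ≡-Reasoning

    countUpTo-window : ∀ X → countUpTo (window X) P ≡ countPeriod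
    countUpTo-window zero    = countUpTo-cong (window 0) +_
      (λ i → subst S (ℤ.+-identityʳ (+ i))) (λ i → subst S (sym (ℤ.+-identityʳ (+ i)))) P
    countUpTo-window (suc X) = begin
      countUpTo (window (suc X)) P
        ≡⟨ countUpTo-rotate (suc X) ⟨
      countUpTo (window (suc X) ∘ suc) P
        ≡⟨ countUpTo-cong (window (suc X) ∘ suc) (window X)
             (λ i → subst S (window-suc X i)) (λ i → subst S (sym (window-suc X i))) P ⟩
      countUpTo (window X) P
        ≡⟨ countUpTo-window X ⟩
      countPeriod ∎
      where open ≡-Reasoning

    countUpTo-periods : ∀ X q r →
      countUpTo (window X) (q ℕ.* P ℕ.+ r) ≡ q ℕ.* countPeriod ℕ.+ countUpTo (window X) r
    countUpTo-periods X zero    r = refl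
    countUpTo-periods X (suc q) r = begin
      countUpTo (window X) (P ℕ.+ q ℕ.* P ℕ.+ r)
        ≡⟨ cong (countUpTo (window X)) (ℕ.+-assoc P (q ℕ.* P) r) ⟩
      countUpTo (window X) (P ℕ.+ (q ℕ.* P ℕ.+ r))
        ≡⟨ countUpTo-+ (window X) P (q ℕ.* P ℕ.+ r) ⟩
      countUpTo (window X) P ℕ.+ countUpTo (λ i → window X (P ℕ.+ i)) (q ℕ.* P ℕ.+ r)
        ≡⟨ cong₂ ℕ._+_ (countUpTo-window X)
             (countUpTo-cong (λ i → window X (P ℕ.+ i)) (window X)
               (shift-down X) (shift-up X) (q ℕ.* P ℕ.+ r)) ⟩
      countPeriod ℕ.+ countUpTo (window X) (q ℕ.* P ℕ.+ r)
        ≡⟨ cong (countPeriod ℕ.+_) (countUpTo-periods X q r) ⟩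
      countPeriod ℕ.+ (q ℕ.* countPeriod ℕ.+ countUpTo (window X) r)
        ≡⟨ ℕ.+-assoc countPeriod (q ℕ.* countPeriod) (countUpTo (window X) r) ⟨
      countPeriod ℕ.+ q ℕ.* countPeriod ℕ.+ countUpTo (window X) r ∎
      where open ≡-Reasoning

    module _ (X L : ℕ) {{L≢0 : ℕ.NonZero L}} where
      private
        c = countPeriod
        q = L / P
        r = L % P
        s = countUpTo (window X) r
        n = countUpTo (window X) L

        L≡ : L ≡ q ℕ.* P ℕ.+ r
        L≡ = trans (m≡m%n+[m/n]*n L P) (ℕ.+-comm r (q ℕ.* P))

        n≡ : n ≡ q ℕ.* c ℕ.+ s
        n≡ = trans (cong (countUpTo (window X)) L≡) (countUpTo-periods X q r)

        r≤P : r ℕ.≤ P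
        r≤P = ℕ.<⇒≤ (m%n<n L P)

        upper : n ℕ.* P ℕ.≤ c ℕ.* L ℕ.+ P ℕ.* P
        upper = begin
          n ℕ.* P                            ≡⟨ cong (ℕ._* P) n≡ ⟩
          (q ℕ.* c ℕ.+ s) ℕ.* P              ≡⟨ solve 4 (λ q c s p → (q :* c :+ s) :* p := c :* (q :* p) :+ s :* p) refl q c s P ⟩
          c ℕ.* (q ℕ.* P) ℕ.+ s ℕ.* P        ≤⟨ ℕ.+-mono-≤ (ℕ.*-monoʳ-≤ c (ℕ.≤-trans (ℕ.m≤m+n (q ℕ.* P) r) (ℕ.≤-reflexive (sym L≡))))
                                                  (ℕ.*-monoˡ-≤ P (ℕ.≤-trans (countUpTo-≤ (window X) r) r≤P)) ⟩
          c ℕ.* L ℕ.+ P ℕ.* P                ∎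
          where
          open ℕ.≤-Reasoning
          open ℕSolver.+-*-Solver using (solve; _:+_; _:*_; _:=_)

        lower : c ℕ.* L ℕ.≤ n ℕ.* P ℕ.+ P ℕ.* P
        lower = begin
          c ℕ.* L                            ≡⟨ cong (c ℕ.*_) L≡ ⟩
          c ℕ.* (q ℕ.* P ℕ.+ r)              ≡⟨ solve 4 (λ q c r p → c :* (q :* p :+ r) := (q :* c) :* p :+ c :* r) refl q c r P ⟩
          q ℕ.* c ℕ.* P ℕ.+ c ℕ.* r          ≤⟨ ℕ.+-mono-≤ (ℕ.*-monoˡ-≤ P (ℕ.≤-trans (ℕ.m≤m+n (q ℕ.* c) s) (ℕ.≤-reflexive (sym n≡))))
                                                  (ℕ.*-mono-≤ (countUpTo-≤ +_ P) r≤P) ⟩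
          n ℕ.* P ℕ.+ P ℕ.* P                ∎
          where
          open ℕ.≤-Reasoning
          open ℕSolver.+-*-Solver using (solve; _:+_; _:*_; _:=_)

      countUpTo-close : ∣ (+ n ℚ./ L) ℚ.- (+ c ℚ./ P) ∣ ℚ.≤ (+ P ℚ./ L)
      countUpTo-close = ∣x-y∣≤ {+ n ℚ./ L} {+ c ℚ./ P} {+ P ℚ./ L}
        (subst ((+ n ℚ./ L) ℚ.≤_) (sym (frac-+ c P P L))
          (frac-≤ n L (c ℕ.* L ℕ.+ P ℕ.* P) (P ℕ.* L) (begin
            n ℕ.* (P ℕ.* L)                  ≡⟨ ℕ.*-assoc n P L ⟨
            n ℕ.* P ℕ.* L                    ≤⟨ ℕ.*-monoˡ-≤ L upper ⟩
            (c ℕ.* L ℕ.+ P ℕ.* P) ℕ.* L      ∎)))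
        (subst ((+ c ℚ./ P) ℚ.≤_) (sym (frac-+ n L P L))
          (frac-≤ c P (n ℕ.* L ℕ.+ P ℕ.* L) (L ℕ.* L) (begin
            c ℕ.* (L ℕ.* L)                  ≡⟨ ℕ.*-assoc c L L ⟨
            c ℕ.* L ℕ.* L                    ≤⟨ ℕ.*-monoˡ-≤ L lower ⟩
            (n ℕ.* P ℕ.+ P ℕ.* P) ℕ.* L      ≡⟨ solve 3 (λ n p l → (n :* p :+ p :* p) :* l := (n :* l :+ p :* l) :* p) refl n P L ⟩
            (n ℕ.* L ℕ.+ P ℕ.* L) ℕ.* P      ∎)))
        where
        instance
          P*L≢0 = ℕ.m*n≢0 P L
          L*L≢0 = ℕ.m*n≢0 L L
        open ℕ.≤-Reasoning
        open ℕSolver.+-*-Solver using (solve; _:+_; _:*_; _:=_)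

    periodic-density : HasDensity (+ countPeriod ℚ./ P)
    periodic-density ε 0<ε =
      let K , below = archimedean P ε 0<ε
      in K , λ X K≤X → ℚ.≤-<-trans (countUpTo-close X (suc (2 ℕ.* X)))
           (below (suc (2 ℕ.* X))
             (ℕ.≤-trans K≤X (ℕ.m≤n⇒m≤1+n (ℕ.m≤m+n X (X ℕ.+ 0)))))

ResidueClass : Set
ResidueClass = ℕ⁺ × ℕ

infix 4 _∈ᶜ_ _∈ᶜ?_

_∈ᶜ_ : ℤ → ResidueClass → Set
m ∈ᶜ (n , r) = + value n ∣ m ℤ.- + r

_∈ᶜ?_ : ∀ m c → Dec (m ∈ᶜ c)
m ∈ᶜ? (n , r) = + value n ∣? (m ℤ.- + r)

System : Set
System = List ResidueClass

Uncovered : System → Pred ℤ 0ℓ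
Uncovered C m = All (λ c → ¬ (m ∈ᶜ c)) C

uncovered? : ∀ C → Decidable (Uncovered C)
uncovered? C m = All.all? (λ c → ¬? (m ∈ᶜ? c)) C

period : System → ℕ
period C = product (map (value ∘ proj₁) C)

period≢0 : ∀ C → ℕ.NonZero (period C)
period≢0 C = product≢0 (map⁺ (All.universal (value≢0 ∘ proj₁) C))

private
  ∈ᶜ-shift : ∀ {P} m c → + value (proj₁ c) ∣ P → m ℤ.+ P ∈ᶜ c → m ∈ᶜ c
  ∈ᶜ-shift {P} m (n , r) n∣P h = ∣m+n∣m⇒∣n (subst (+ value n ∣_) rearrange h) n∣P
    where
    rearrange : m ℤ.+ P ℤ.- + r ≡ P ℤ.+ (m ℤ.- + r)
    rearrange = solve 3 (λ m p r → (m :+ p) :- r := p :+ (m :- r)) refl m P (+ r)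
      where open ℤSolver.+-*-Solver

  ∈ᶜ-unshift : ∀ {P} m c → + value (proj₁ c) ∣ P → m ∈ᶜ c → m ℤ.+ P ∈ᶜ c
  ∈ᶜ-unshift {P} m (n , r) n∣P h = subst (+ value n ∣_) rearrange (∣m∣n⇒∣m+n n∣P h)
    where
    rearrange : P ℤ.+ (m ℤ.- + r) ≡ m ℤ.+ P ℤ.- + r
    rearrange = solve 3 (λ m p r → p :+ (m :- r) := (m :+ p) :- r) refl m P (+ r)
      where open ℤSolver.+-*-Solver

moduli∣period : ∀ C → All (λ c → + value (proj₁ c) ∣ + period C) C
moduli∣period []            = []
moduli∣period ((n , r) ∷ C) =
  ∣ᵤ⇒∣ (ℕ.m∣m*n (period C)) ∷
  All.map (λ n∣P → ∣ᵤ⇒∣ (ℕ.∣n⇒∣m*n (value n) (∣⇒∣ᵤ n∣P))) (moduli∣period C)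

uncovered-up : ∀ C m → Uncovered C m → Uncovered C (m ℤ.+ + period C)
uncovered-up C m u = All.zipWith
  (λ {c} (n∣P , ¬h) h → ¬h (∈ᶜ-shift m c n∣P h)) (moduli∣period C , u)

uncovered-down : ∀ C m → Uncovered C (m ℤ.+ + period C) → Uncovered C m
uncovered-down C m u = All.zipWith
  (λ {c} (n∣P , ¬h) h → ¬h (∈ᶜ-unshift m c n∣P h)) (moduli∣period C , u)

density : ∀ C → ∃ λ d → HasDensity (uncovered? C) d
density C = _ , Periodic.periodic-density (uncovered? C) (period C) {{period≢0 C}}
  (uncovered-up C) (uncovered-down C)

density-unique : ∀ C {d d′} → HasDensity (uncovered? C) d → HasDensity (uncovered? C) d′ → d ≡ d′
density-unique C {d} {d′} = ⟶-unique {λ X → + count (uncovered? C) (symmetricRange X) ℚ./ suc (2 ℕ.* X)} {d} {d′}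

δ : System → ℚ
δ C = proj₁ (density C)

-- A finite set of moduli is a duplicate-free list; 𝒞 T then lists each system once.
𝒞 : List ℕ⁺ → List System
𝒞 []      = [] ∷ []
𝒞 (n ∷ T) = cartesianProductWith (λ r C → (n , r) ∷ C) (applyUpTo suc (value n)) (𝒞 T)

W : List ℕ⁺ → ℕ
W T = length (𝒞 T)

private
  length-cartesianProductWith : ∀ {A B C : Set} (f : A → B → C) xs ys →
    length (cartesianProductWith f xs ys) ≡ length xs ℕ.* length ys
  length-cartesianProductWith f []       ys = refl
  length-cartesianProductWith f (x ∷ xs) ys = trans (length-++ (map (f x) ys))
    (cong₂ ℕ._+_ (length-map (f x) ys) (length-cartesianProductWith f xs ys))

W≡product : ∀ T → W T ≡ product (map value T)
W≡product []      = refl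
W≡product (n ∷ T) = trans (length-cartesianProductWith _ (applyUpTo suc (value n)) (𝒞 T))
  (cong₂ ℕ._*_ (length-applyUpTo suc (value n)) (W≡product T))

W≢0 : ∀ T → ℕ.NonZero (W T)
W≢0 T = subst ℕ.NonZero (sym (W≡product T)) (product≢0 (map⁺ (All.universal value≢0 T)))

average : (System → ℚ) → List ℕ⁺ → ℚ
average f T = (+ 1 ℚ./ W T) {{W≢0 T}} ℚ.* ∑ (map f (𝒞 T))

α : List ℕ⁺ → ℚ
α T = ∏ (map (λ n → 1ℚ ℚ.- recip n) T)

IsMinimum : ℕ⁺ → List ℕ⁺ → Set
IsMinimum N T = N ∈ T × All (λ n → value N ℕ.≤ value n) T

module Submission where

{- The second moment of δ(C) is the mean over k of ∏ (1 − 2/n + [n ∣ k]/n), the probability that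
two integers at distance k are both uncovered.  Write this as β F(k) with β = ∏ (1 − 2/n) and
F(k) = ∏_{n ∣ k} (1 + 1/(n−2)).  Telescoping gives F_{<m}(k) ≤ (m−2)/(N−2) for the part of the
product with n < m, hence F(k) ≤ 1 + ∑_{n ∣ k} 1/(n−2) + 1/(N−2) ∑_{l<n; l,n ∣ k} 1/(n−2).
On averaging over k, the first two terms give at most α²/β because (1 − 2/n)(1 + 1/(n(n−2))) = (1 − 1/n)²,
and as β ≤ α² the variance is at most α²/(N−2) · ∑_{l<n} 1/((n−2) lcm(l,n)).
Up to a constant the last sum is ∑_{l<n} gcd(l,n)/(l n²) ≤ ∑_{l≥N} d(l)/l² = O(log N / N). -}

open import Defs
open import Data.List.Base using (List)
open import Data.List.Relation.Unary.Unique.Propositional using (Unique)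
open import Data.Nat.Base using (_≤_)
open import Data.Product.Base using (∃; _×_)
open import Data.Rational.Base using (_-_; ∣_∣)

open import Data.Bool.Base using (if_then_else_)
open import Data.Integer.Base as ℤ using (ℤ)
open import Data.Integer.Divisibility.Signed as ℤ using (_∣_; _∣?_)
import Data.Integer.Properties as ℤ
import Data.Integer.Solver
open import Data.List.Base using ([]; _∷_; _++_; map; applyUpTo; upTo; cartesianProductWith; filter; length)
open import Data.List.Membership.Propositional.Properties using (∈-cartesianProductWith⁻)
open import Data.List.Properties using (map-cong; map-∘; map-applyUpTo; map-upTo; length-applyUpTo)
open import Data.List.Relation.Binary.Permutation.Propositional using (_↭_; ↭-sym; ↭⇒↭ₛ)
import Data.List.Relation.Binary.Permutation.Propositional.Properties as ↭
open import Data.List.Relation.Binary.Permutation.Setoid.Properties using (Unique-resp-↭; foldr-commMonoid)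
open import Data.List.Relation.Unary.All as All using (All; []; _∷_)
import Data.List.Relation.Unary.All.Properties as All
open import Data.List.Relation.Unary.AllPairs as AllPairs using (AllPairs; []; _∷_)
open import Data.List.Relation.Unary.Linked.Properties using (Linked⇒AllPairs)
import Data.List.Relation.Unary.Unique.Propositional.Properties as Unique
open import Data.Nat.Base as ℕ using (ℕ; zero; suc; z≤n; s≤s)
open import Data.Nat.DivMod using (_/_; m/n*n≤m; m%n<n; m≡m%n+[m/n]*n; m≥n⇒m/n>0)
import Data.Nat.Divisibility as ℕ
open import Data.Nat.GCD using (gcd; gcd[m,n]∣m; gcd[m,n]∣n; gcd[m,n]≢0)
open import Data.Nat.LCM using (lcm; lcm-least; gcd*lcm)
open import Data.Nat.ListAction using (product)
open import Data.Nat.ListAction.Properties using (∈⇒∣product)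
import Data.Nat.Properties as ℕ
open import Data.Product.Base using (_,_; proj₁)
open import Data.Rational.Base as ℚ using (ℚ; 0ℚ; 1ℚ; _+_; _*_; -_)
import Data.Rational.Properties as ℚ
open import Data.Rational.Solver using (module +-*-Solver)
open import Data.Sum.Base using (inj₁; inj₂)
open import Function.Base using (_∘_; id)
open import Level using (0ℓ)
import Relation.Binary.Construct.Flip.EqAndOrd as Flip
open import Relation.Binary.PropositionalEquality
  using (_≡_; _≗_; refl; sym; trans; cong; cong₂; subst; subst₂; setoid; module ≡-Reasoning)
open import Relation.Nullary using (Dec; does; yes; no; ¬_; contradiction)
open import Relation.Unary using (Pred; Decidable)

open import Data.List.Sort (Flip.decTotalOrder ℕ.≤-decTotalOrder) using (sort; sort-↭; sort-↗)
open +-*-Solver using (solve; _:=_; _:+_; _:*_; _:-_; :-_; con)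
private module ℤS = Data.Integer.Solver.+-*-Solver

-- The largest element of `T` is unbounded, so the expansion of F(k) must lose no factor depending
-- on it. Letting the moduli enter in increasing order achieves this: the growth allowed to the
-- product over the moduli below n is cancelled by the weight 1/(n-2) of n itself. All terms of
-- order two and higher thus collapse into pairs and share the prefactor 1/(N-2). The first-order
-- terms admit no constant loss at all, because α² is subtracted afterwards; only the pairs may be
-- estimated crudely. The hypothesis N ≥ 3 keeps 1 - 2/n positive. The saving log N/N² is 1/N from
-- the prefactor times log N/N from the gcd sum, where log N is the harmonic sum over divisors g <
-- N. Two integers i and j are averaged over one period common to all systems. For fixed j the
-- difference i - j runs through a complete period, so frequencies of divisibility are exact and no
-- error term arises. The real number log N enters only through its Riemann sums, each of which
-- already dominates 1/2 + ... + 1/N, so the whole estimate is rational.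

private variable
  A B : Set

-- Ordered-field arithmetic

*-monoˡ : ∀ r {p q} → 0ℚ ℚ.≤ r → p ℚ.≤ q → r * p ℚ.≤ r * q
*-monoˡ r 0≤r = ℚ.*-monoˡ-≤-nonNeg r {{ℚ.nonNegative 0≤r}}

*-monoʳ : ∀ r {p q} → 0ℚ ℚ.≤ r → p ℚ.≤ q → p * r ℚ.≤ q * r
*-monoʳ r 0≤r = ℚ.*-monoʳ-≤-nonNeg r {{ℚ.nonNegative 0≤r}}

*-mono : ∀ {p q r s} → 0ℚ ℚ.≤ p → 0ℚ ℚ.≤ s → p ℚ.≤ q → r ℚ.≤ s → p * r ℚ.≤ q * s
*-mono {p} {s = s} 0≤p 0≤s p≤q r≤s = ℚ.≤-trans (*-monoˡ p 0≤p r≤s) (*-monoʳ s 0≤s p≤q)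

0≤+ : ∀ {p q} → 0ℚ ℚ.≤ p → 0ℚ ℚ.≤ q → 0ℚ ℚ.≤ p + q
0≤+ = ℚ.+-mono-≤

0≤* : ∀ {p q} → 0ℚ ℚ.≤ p → 0ℚ ℚ.≤ q → 0ℚ ℚ.≤ p * q
0≤* {p} {q} 0≤p 0≤q = subst (ℚ._≤ p * q) (ℚ.*-zeroʳ p) (*-monoˡ p 0≤p 0≤q)

p≤p+q : ∀ p {q} → 0ℚ ℚ.≤ q → p ℚ.≤ p + q
p≤p+q p {q} 0≤q = subst (ℚ._≤ p + q) (ℚ.+-identityʳ p) (ℚ.+-monoʳ-≤ p 0≤q)

p≤q+p : ∀ {p q} → 0ℚ ℚ.≤ q → p ℚ.≤ q + p
p≤q+p {p} {q} 0≤q = subst (ℚ._≤ q + p) (ℚ.+-identityˡ p) (ℚ.+-monoˡ-≤ p 0≤q)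

p≤q⇒0≤q-p : ∀ {p q} → p ℚ.≤ q → 0ℚ ℚ.≤ q - p
p≤q⇒0≤q-p {p} {q} p≤q = subst (ℚ._≤ q - p) (ℚ.+-inverseʳ p) (ℚ.+-monoˡ-≤ (- p) p≤q)

p²-nonNeg : ∀ p → 0ℚ ℚ.≤ p * p
p²-nonNeg p with ℚ.≤-total 0ℚ p
... | inj₁ 0≤p = 0≤* 0≤p 0≤p
... | inj₂ p≤0 = subst (0ℚ ℚ.≤_) (solve 1 (λ p → (:- p) :* (:- p) := p :* p) refl p)
  (0≤* (ℚ.neg-antimono-≤ p≤0) (ℚ.neg-antimono-≤ p≤0))

∣p∣²≡p² : ∀ p → ∣ p ∣ ² ≡ p * p
∣p∣²≡p² p = trans (sym (ℚ.∣p*q∣≡∣p∣*∣q∣ p p)) (ℚ.0≤p⇒∣p∣≡p (p²-nonNeg p))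

-- Recursive, so that `ι (suc n)` unfolds to `1ℚ + ι n` and the ring solver evaluates closed
-- constants such as `ι 126`.
ι : ℕ → ℚ
ι zero    = 0ℚ
ι (suc n) = 1ℚ + ι n

-- The junk value inv 0 = 0 keeps inv multiplicative.
inv : ℕ → ℚ
inv zero    = 0ℚ
inv (suc n) = ℤ.+ 1 ℚ./ suc n

1/n≡inv : ∀ n .{{_ : ℕ.NonZero n}} → (ℤ.+ 1 ℚ./ n) ≡ inv n
1/n≡inv (suc n) = refl

0≤1 : 0ℚ ℚ.≤ 1ℚ
0≤1 = ℚ.nonNegative⁻¹ 1ℚ

0≤ι : ∀ n → 0ℚ ℚ.≤ ι n
0≤ι zero    = ℚ.≤-refl
0≤ι (suc n) = 0≤+ 0≤1 (0≤ι n)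

0≤inv : ∀ n → 0ℚ ℚ.≤ inv n
0≤inv zero    = ℚ.≤-refl
0≤inv (suc n) = frac-≤ 0 1 1 (suc n) z≤n

inv-antitone : ∀ {m n} .{{_ : ℕ.NonZero m}} → m ≤ n → inv n ℚ.≤ inv m
inv-antitone {suc m} {suc n} m≤n = frac-≤ 1 (suc n) 1 (suc m) (ℕ.*-monoʳ-≤ 1 m≤n)

1/n+m/n : ∀ m n .{{_ : ℕ.NonZero n}} → (ℤ.+ 1 ℚ./ n) + (ℤ.+ m ℚ./ n) ≡ ℤ.+ suc m ℚ./ n
1/n+m/n m n = trans (frac-+ 1 n m n)
  (ℚ.≤-antisym (frac-≤ (1 ℕ.* n ℕ.+ m ℕ.* n) (n ℕ.* n) (suc m) n (ℕ.≤-reflexive (sym eq)))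
               (frac-≤ (suc m) n (1 ℕ.* n ℕ.+ m ℕ.* n) (n ℕ.* n) (ℕ.≤-reflexive eq)))
  where
  instance _ = ℕ.m*n≢0 n n
  eq : suc m ℕ.* (n ℕ.* n) ≡ (1 ℕ.* n ℕ.+ m ℕ.* n) ℕ.* n
  eq = trans (sym (ℕ.*-assoc (suc m) n n)) (cong (λ z → (z ℕ.+ m ℕ.* n) ℕ.* n) (sym (ℕ.*-identityˡ n)))

m/n≡ : ∀ m n .{{_ : ℕ.NonZero n}} → ℤ.+ m ℚ./ n ≡ ι m * inv n
m/n≡ zero    n = trans (ℚ.0/n≡0 n) (sym (ℚ.*-zeroˡ (inv n)))
m/n≡ (suc m) n = trans (sym (1/n+m/n m n)) (trans (cong₂ _+_ (1/n≡inv n) (m/n≡ m n))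
  (solve 2 (λ i m → i :+ m :* i := (con 1ℚ :+ m) :* i) refl (inv n) (ι m)))

ι*inv : ∀ n .{{_ : ℕ.NonZero n}} → ι n * inv n ≡ 1ℚ
ι*inv n = trans (sym (m/n≡ n n)) (ℚ.≤-antisym
  (frac-≤ n n 1 1 (ℕ.≤-reflexive (ℕ.*-comm n 1))) (frac-≤ 1 1 n n (ℕ.≤-reflexive (ℕ.*-comm 1 n))))

ι-+ : ∀ m n → ι (m ℕ.+ n) ≡ ι m + ι n
ι-+ zero    n = sym (ℚ.+-identityˡ (ι n))
ι-+ (suc m) n = trans (cong (1ℚ +_) (ι-+ m n)) (sym (ℚ.+-assoc 1ℚ (ι m) (ι n)))

ι-* : ∀ m n → ι (m ℕ.* n) ≡ ι m * ι n
ι-* zero    n = sym (ℚ.*-zeroˡ (ι n))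
ι-* (suc m) n = trans (ι-+ n (m ℕ.* n)) (trans (cong (λ z → ι n + z) (ι-* m n))
  (solve 2 (λ m n → n :+ m :* n := (con 1ℚ :+ m) :* n) refl (ι m) (ι n)))

ι-mono : ∀ {m n} → m ≤ n → ι m ℚ.≤ ι n
ι-mono {n = n} z≤n   = 0≤ι n
ι-mono (s≤s m≤n) = ℚ.+-monoʳ-≤ 1ℚ (ι-mono m≤n)

inv-* : ∀ m n → inv (m ℕ.* n) ≡ inv m * inv n
inv-* zero      n         = sym (ℚ.*-zeroˡ (inv n))
inv-* m@(suc _) zero      = trans (cong inv (ℕ.*-zeroʳ m)) (sym (ℚ.*-zeroʳ (inv m)))
inv-* m@(suc _) n@(suc _) = begin
  inv (m ℕ.* n)
    ≡⟨ solve 1 (λ x → x := x :* (con 1ℚ :* con 1ℚ)) refl (inv (m ℕ.* n)) ⟩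
  inv (m ℕ.* n) * (1ℚ * 1ℚ)
    ≡⟨ cong₂ (λ x y → inv (m ℕ.* n) * (x * y)) (ι*inv m) (ι*inv n) ⟨
  inv (m ℕ.* n) * ((ι m * inv m) * (ι n * inv n))
    ≡⟨ solve 5 (λ x m i n j → x :* ((m :* i) :* (n :* j)) := ((m :* n) :* x) :* (i :* j))
         refl (inv (m ℕ.* n)) (ι m) (inv m) (ι n) (inv n) ⟩
  ((ι m * ι n) * inv (m ℕ.* n)) * (inv m * inv n)
    ≡⟨ cong (λ x → (x * inv (m ℕ.* n)) * (inv m * inv n)) (ι-* m n) ⟨
  (ι (m ℕ.* n) * inv (m ℕ.* n)) * (inv m * inv n)
    ≡⟨ cong (_* (inv m * inv n)) (ι*inv (m ℕ.* n)) ⟩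
  1ℚ * (inv m * inv n)
    ≡⟨ ℚ.*-identityˡ _ ⟩
  inv m * inv n ∎
  where open ≡-Reasoning

-- Finite sums

∑[_] : List A → (A → ℚ) → ℚ
∑[ xs ] f = ∑ (map f xs)

∏[_] : List A → (A → ℚ) → ℚ
∏[ xs ] f = ∏ (map f xs)

∑-cong : ∀ {f g : A → ℚ} → f ≗ g → ∀ xs → ∑[ xs ] f ≡ ∑[ xs ] g
∑-cong f≗g xs = cong ∑ (map-cong f≗g xs)

∏-cong : ∀ {f g : A → ℚ} → f ≗ g → ∀ xs → ∏[ xs ] f ≡ ∏[ xs ] g
∏-cong f≗g xs = cong ∏ (map-cong f≗g xs)

∑-mono : ∀ {f g : A → ℚ} {xs} → All (λ x → f x ℚ.≤ g x) xs → ∑[ xs ] f ℚ.≤ ∑[ xs ] g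
∑-mono []        = ℚ.≤-refl
∑-mono (p ∷ ps) = ℚ.+-mono-≤ p (∑-mono ps)

∑-mono′ : ∀ {f g : A → ℚ} → (∀ x → f x ℚ.≤ g x) → ∀ xs → ∑[ xs ] f ℚ.≤ ∑[ xs ] g
∑-mono′ f≤g xs = ∑-mono (All.universal f≤g xs)

∑-0 : ∀ (xs : List A) → ∑[ xs ] (λ _ → 0ℚ) ≡ 0ℚ
∑-0 []       = refl
∑-0 (x ∷ xs) = trans (ℚ.+-identityˡ _) (∑-0 xs)

∑-nonNeg : ∀ {f : A → ℚ} → (∀ x → 0ℚ ℚ.≤ f x) → ∀ xs → 0ℚ ℚ.≤ ∑[ xs ] f
∑-nonNeg 0≤f []       = ℚ.≤-refl
∑-nonNeg 0≤f (x ∷ xs) = 0≤+ (0≤f x) (∑-nonNeg 0≤f xs)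

∏-nonNeg : ∀ {f : A → ℚ} {xs} → All (λ x → 0ℚ ℚ.≤ f x) xs → 0ℚ ℚ.≤ ∏[ xs ] f
∏-nonNeg []       = 0≤1
∏-nonNeg (p ∷ ps) = 0≤* p (∏-nonNeg ps)

∏-mono : ∀ {f g : A → ℚ} {xs} → All (λ x → 0ℚ ℚ.≤ f x) xs → All (λ x → f x ℚ.≤ g x) xs →
         ∏[ xs ] f ℚ.≤ ∏[ xs ] g
∏-mono []       []       = ℚ.≤-refl
∏-mono (p ∷ ps) (q ∷ qs) = *-mono p (ℚ.≤-trans (∏-nonNeg ps) (∏-mono ps qs)) q (∏-mono ps qs)

∑-+ : ∀ (f g : A → ℚ) xs → ∑[ xs ] (λ x → f x + g x) ≡ ∑[ xs ] f + ∑[ xs ] g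
∑-+ f g []       = refl
∑-+ f g (x ∷ xs) = trans (cong (f x + g x +_) (∑-+ f g xs))
  (solve 4 (λ a b c d → a :+ b :+ (c :+ d) := a :+ c :+ (b :+ d)) refl (f x) (g x) (∑[ xs ] f) (∑[ xs ] g))

∑-*ˡ : ∀ c (f : A → ℚ) xs → ∑[ xs ] (λ x → c * f x) ≡ c * ∑[ xs ] f
∑-*ˡ c f []       = sym (ℚ.*-zeroʳ c)
∑-*ˡ c f (x ∷ xs) = trans (cong (c * f x +_) (∑-*ˡ c f xs)) (sym (ℚ.*-distribˡ-+ c (f x) (∑[ xs ] f)))

∑-*ʳ : ∀ c (f : A → ℚ) xs → ∑[ xs ] (λ x → f x * c) ≡ ∑[ xs ] f * c
∑-*ʳ c f xs = trans (∑-cong (λ x → ℚ.*-comm (f x) c) xs) (trans (∑-*ˡ c f xs) (ℚ.*-comm c _))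

∑-swap : ∀ (f : A → B → ℚ) xs ys → ∑[ xs ] (λ x → ∑[ ys ] (f x)) ≡ ∑[ ys ] (λ y → ∑[ xs ] (λ x → f x y))
∑-swap f []       ys = sym (∑-0 ys)
∑-swap f (x ∷ xs) ys = trans (cong (∑[ ys ] (f x) +_) (∑-swap f xs ys)) (sym (∑-+ (f x) _ ys))

∑-++ : ∀ (f : A → ℚ) xs ys → ∑[ xs ++ ys ] f ≡ ∑[ xs ] f + ∑[ ys ] f
∑-++ f []       ys = sym (ℚ.+-identityˡ _)
∑-++ f (x ∷ xs) ys = trans (cong (f x +_) (∑-++ f xs ys)) (sym (ℚ.+-assoc (f x) _ _))

∑-map : ∀ (f : B → ℚ) (g : A → B) xs → ∑[ map g xs ] f ≡ ∑[ xs ] (f ∘ g)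
∑-map f g xs = cong ∑ (sym (map-∘ xs))

∏-map : ∀ (f : B → ℚ) (g : A → B) xs → ∏[ map g xs ] f ≡ ∏[ xs ] (f ∘ g)
∏-map f g xs = cong ∏ (sym (map-∘ xs))

∏-* : ∀ (f g : A → ℚ) xs → ∏[ xs ] (λ x → f x * g x) ≡ ∏[ xs ] f * ∏[ xs ] g
∏-* f g []       = refl
∏-* f g (x ∷ xs) = trans (cong (f x * g x *_) (∏-* f g xs))
  (solve 4 (λ a b c d → a :* b :* (c :* d) := a :* c :* (b :* d)) refl (f x) (g x) (∏[ xs ] f) (∏[ xs ] g))

∑-const : ∀ c (xs : List A) → ∑[ xs ] (λ _ → c) ≡ ι (length xs) * c
∑-const c []       = sym (ℚ.*-zeroˡ c)
∑-const c (x ∷ xs) = trans (cong (c +_) (∑-const c xs))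
  (solve 2 (λ c l → c :+ l :* c := (con 1ℚ :+ l) :* c) refl c (ι (length xs)))

∑-cong-All : ∀ {f g : A → ℚ} {xs} → All (λ x → f x ≡ g x) xs → ∑[ xs ] f ≡ ∑[ xs ] g
∑-cong-All []       = refl
∑-cong-All (p ∷ ps) = cong₂ _+_ p (∑-cong-All ps)

∏-cong-All : ∀ {f g : A → ℚ} {xs} → All (λ x → f x ≡ g x) xs → ∏[ xs ] f ≡ ∏[ xs ] g
∏-cong-All []       = refl
∏-cong-All (p ∷ ps) = cong₂ _*_ p (∏-cong-All ps)

-- Indicators of decidable propositions

⟦_⟧ : Dec A → ℚ
⟦ d ⟧ = if does d then 1ℚ else 0ℚ

⟦⟧-mono : (d : Dec A) (e : Dec B) → (A → B) → ⟦ d ⟧ ℚ.≤ ⟦ e ⟧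
⟦⟧-mono (yes a) (yes b) f = ℚ.≤-refl
⟦⟧-mono (yes a) (no ¬b) f = contradiction (f a) ¬b
⟦⟧-mono (no ¬a) (yes b) f = 0≤1
⟦⟧-mono (no ¬a) (no ¬b) f = ℚ.≤-refl

⟦⟧-cong : (d : Dec A) (e : Dec B) → (A → B) → (B → A) → ⟦ d ⟧ ≡ ⟦ e ⟧
⟦⟧-cong d e f g = ℚ.≤-antisym (⟦⟧-mono d e f) (⟦⟧-mono e d g)

0≤⟦⟧ : (d : Dec A) → 0ℚ ℚ.≤ ⟦ d ⟧
0≤⟦⟧ (yes _) = 0≤1
0≤⟦⟧ (no _)  = ℚ.≤-refl

⟦⟧≤1 : (d : Dec A) → ⟦ d ⟧ ℚ.≤ 1ℚ
⟦⟧≤1 (yes _) = ℚ.≤-refl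
⟦⟧≤1 (no _)  = 0≤1

⟦⟧≡1 : (d : Dec A) → A → ⟦ d ⟧ ≡ 1ℚ
⟦⟧≡1 (yes _) a = refl
⟦⟧≡1 (no ¬a) a = contradiction a ¬a

⟦⟧≡0 : (d : Dec A) → ¬ A → ⟦ d ⟧ ≡ 0ℚ
⟦⟧≡0 (yes a) ¬a = contradiction a ¬a
⟦⟧≡0 (no _)  ¬a = refl

⟦⟧*⟦⟧≤ : {C : Set} (d : Dec A) (e : Dec B) (f : Dec C) → (A → B → C) → ⟦ d ⟧ * ⟦ e ⟧ ℚ.≤ ⟦ f ⟧
⟦⟧*⟦⟧≤ (yes a) e f g = subst (ℚ._≤ ⟦ f ⟧) (sym (ℚ.*-identityˡ ⟦ e ⟧)) (⟦⟧-mono e f (g a))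
⟦⟧*⟦⟧≤ (no _)  e f g = subst (ℚ._≤ ⟦ f ⟧) (sym (ℚ.*-zeroˡ ⟦ e ⟧)) (0≤⟦⟧ f)

ι-length-filter : ∀ {P : Pred A 0ℓ} (P? : Decidable P) xs →
                  ι (length (filter P? xs)) ≡ ∑[ xs ] (λ x → ⟦ P? x ⟧)
ι-length-filter P? []       = refl
ι-length-filter P? (x ∷ xs) with P? x
... | yes _ = cong (1ℚ +_) (ι-length-filter P? xs)
... | no _  = trans (ι-length-filter P? xs) (sym (ℚ.+-identityˡ _))

∑-applyUpTo : ∀ (f : A → ℚ) (g : ℕ → A) n → ∑[ applyUpTo g n ] f ≡ ∑[ upTo n ] (f ∘ g)
∑-applyUpTo f g n = cong ∑ (trans (map-applyUpTo g f n) (sym (map-upTo (f ∘ g) n)))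

-- Multiples of L in a window of consecutive integers

module Multiples (L : ℕ) {{L≢0 : ℕ.NonZero L}} where

  multiple? : Decidable (ℤ.+ L ∣_)
  multiple? m = ℤ.+ L ∣? m

  open Periodic multiple? L
    (λ m h → ℤ.∣m∣n⇒∣m+n h (ℤ.∣-refl))
    (λ m h → ℤ.∣m+n∣m⇒∣n (subst (ℤ.+ L ∣_) (ℤ.+-comm m (ℤ.+ L)) h) ℤ.∣-refl)
    public

  -- Among 0, ..., L - 1 only 0 counts, since a positive multiple of `L` is at least `L`.
  ι-countPeriod : ι countPeriod ≡ 1ℚ
  ι-countPeriod = trans (ι-length-filter multiple? (applyUpTo ℤ.+_ L)) (only-zero L ℕ.≤-refl)
    where
    only-zero : ∀ n {{_ : ℕ.NonZero n}} → n ≤ L → ∑[ applyUpTo ℤ.+_ n ] (λ m → ⟦ multiple? m ⟧) ≡ 1ℚ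
    only-zero (suc n) n<L = cong₂ _+_
      (⟦⟧≡1 (multiple? (ℤ.+ 0)) (ℤ.∣ᵤ⇒∣ (L ℕ.∣0)))
      (trans (∑-cong-All (All.applyUpTo⁺₁ (ℤ.+_ ∘ suc) n (λ {i} i<n →
               ⟦⟧≡0 (multiple? (ℤ.+ suc i)) (λ d → ℕ.<⇒≱ (ℕ.≤-trans (s≤s i<n) n<L) (ℕ.∣⇒≤ (ℤ.∣⇒∣ᵤ d))))))
             (∑-0 (applyUpTo (ℤ.+_ ∘ suc) n)))

  ∑-window : ∀ X n → ∑[ upTo n ] (λ i → ⟦ multiple? (ℤ.+ i ℤ.- ℤ.+ X) ⟧) ≡ ι (countUpTo multiple? (window X) n)
  ∑-window X n = trans (sym (∑-applyUpTo (λ m → ⟦ multiple? m ⟧) (window X) n))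
    (sym (ι-length-filter multiple? (applyUpTo (window X) n)))

  -- A window of `q` whole periods has one multiple in each, wherever it starts. The free offset `X`
  -- later becomes the second integer j.
  ∑-multiples : ∀ X q → ∑[ upTo (q ℕ.* L) ] (λ i → ⟦ multiple? (ℤ.+ i ℤ.- ℤ.+ X) ⟧) ≡ ι q
  ∑-multiples X q = begin
    ∑[ upTo (q ℕ.* L) ] (λ i → ⟦ multiple? (ℤ.+ i ℤ.- ℤ.+ X) ⟧)
      ≡⟨ cong (λ z → ∑[ upTo z ] (λ i → ⟦ multiple? (ℤ.+ i ℤ.- ℤ.+ X) ⟧)) (ℕ.+-identityʳ (q ℕ.* L)) ⟨
    ∑[ upTo (q ℕ.* L ℕ.+ 0) ] (λ i → ⟦ multiple? (ℤ.+ i ℤ.- ℤ.+ X) ⟧)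
      ≡⟨ ∑-window X (q ℕ.* L ℕ.+ 0) ⟩
    ι (countUpTo multiple? (window X) (q ℕ.* L ℕ.+ 0))
      ≡⟨ cong ι (trans (countUpTo-periods X q 0) (ℕ.+-identityʳ (q ℕ.* countPeriod))) ⟩
    ι (q ℕ.* countPeriod)
      ≡⟨ trans (ι-* q countPeriod) (cong (ι q *_) ι-countPeriod) ⟩
    ι q * 1ℚ
      ≡⟨ ℚ.*-identityʳ (ι q) ⟩
    ι q ∎
    where open ≡-Reasoning

  multiple-swap : ∀ a b → ℤ.+ L ∣ a ℤ.- b → ℤ.+ L ∣ b ℤ.- a
  multiple-swap a b h = subst (ℤ.+ L ∣_)
    (trans (ℤ.neg-distrib-+ a (ℤ.- b)) (trans (cong (λ z → ℤ.- a ℤ.+ z) (ℤ.neg-involutive b)) (ℤ.+-comm (ℤ.- a) b)))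
    (ℤ.∣m⇒∣-m h)

  -- Changing the sign of the difference lets `r` move through a window; residues run over 1, ..., L
  -- rather than 0, ..., L - 1, hence one rotation of the period.
  ∑-residues : ∀ m → ∑[ applyUpTo suc L ] (λ r → ⟦ multiple? (ℤ.+ m ℤ.- ℤ.+ r) ⟧) ≡ 1ℚ
  ∑-residues m = begin
    ∑[ applyUpTo suc L ] (λ r → ⟦ multiple? (ℤ.+ m ℤ.- ℤ.+ r) ⟧)
      ≡⟨ ∑-cong (λ r → ⟦⟧-cong (multiple? (ℤ.+ m ℤ.- ℤ.+ r)) (multiple? (ℤ.+ r ℤ.- ℤ.+ m))
           (multiple-swap (ℤ.+ m) (ℤ.+ r)) (multiple-swap (ℤ.+ r) (ℤ.+ m))) (applyUpTo suc L) ⟩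
    ∑[ applyUpTo suc L ] (λ r → ⟦ multiple? (ℤ.+ r ℤ.- ℤ.+ m) ⟧)
      ≡⟨ trans (∑-applyUpTo _ suc L) (sym (∑-applyUpTo _ (window m ∘ suc) L)) ⟩
    ∑[ applyUpTo (window m ∘ suc) L ] (λ x → ⟦ multiple? x ⟧)
      ≡⟨ ι-length-filter multiple? (applyUpTo (window m ∘ suc) L) ⟨
    ι (countUpTo multiple? (window m ∘ suc) L)
      ≡⟨ cong ι (trans (countUpTo-rotate m) (countUpTo-window m)) ⟩
    ι countPeriod
      ≡⟨ ι-countPeriod ⟩
    1ℚ ∎
    where open ≡-Reasoning

-- Random systems

∑-cartesianProductWith : ∀ {C : Set} (f : A → B → C) (g : C → ℚ) xs ys →
  ∑[ cartesianProductWith f xs ys ] g ≡ ∑[ xs ] (λ x → ∑[ ys ] (λ y → g (f x y)))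
∑-cartesianProductWith f g []       ys = refl
∑-cartesianProductWith f g (x ∷ xs) ys = trans (∑-++ g (map (f x) ys) _)
  (cong₂ _+_ (∑-map g (f x) ys) (∑-cartesianProductWith f g xs ys))

average-cong : ∀ {f g T} → All (λ C → f C ≡ g C) (𝒞 T) → average f T ≡ average g T
average-cong {T = T} f≡g = cong ((ℤ.+ 1 ℚ./ W T) {{W≢0 T}} *_) (∑-cong-All f≡g)

average-*ˡ : ∀ c f T → average (λ C → c * f C) T ≡ c * average f T
average-*ˡ c f T = trans (cong (w *_) (∑-*ˡ c f (𝒞 T)))
  (solve 3 (λ w c s → w :* (c :* s) := c :* (w :* s)) refl w c (∑[ 𝒞 T ] f))
  where w = (ℤ.+ 1 ℚ./ W T) {{W≢0 T}}

average-+ : ∀ f g T → average (λ C → f C + g C) T ≡ average f T + average g T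
average-+ f g T = trans (cong (w *_) (∑-+ f g (𝒞 T))) (ℚ.*-distribˡ-+ w (∑[ 𝒞 T ] f) (∑[ 𝒞 T ] g))
  where w = (ℤ.+ 1 ℚ./ W T) {{W≢0 T}}

average-∑ : ∀ (f : A → System → ℚ) xs T →
  average (λ C → ∑[ xs ] (λ x → f x C)) T ≡ ∑[ xs ] (λ x → average (f x) T)
average-∑ f xs T = trans (cong (w *_) (∑-swap (λ C x → f x C) (𝒞 T) xs)) (sym (∑-*ˡ w _ xs))
  where w = (ℤ.+ 1 ℚ./ W T) {{W≢0 T}}

average-const : ∀ c T → average (λ _ → c) T ≡ c
average-const c T = begin
  w * ∑[ 𝒞 T ] (λ _ → c)       ≡⟨ cong₂ _*_ (1/n≡inv (W T)) (∑-const c (𝒞 T)) ⟩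
  inv (W T) * (ι (W T) * c)     ≡⟨ solve 3 (λ i w c → i :* (w :* c) := (w :* i) :* c) refl (inv (W T)) (ι (W T)) c ⟩
  (ι (W T) * inv (W T)) * c     ≡⟨ cong (_* c) (ι*inv (W T)) ⟩
  1ℚ * c                        ≡⟨ ℚ.*-identityˡ c ⟩
  c                             ∎
  where
  open ≡-Reasoning
  instance _ = W≢0 T
  w = ℤ.+ 1 ℚ./ W T

∑-∏-𝒞 : ∀ (φ : ResidueClass → ℚ) T →
  ∑[ 𝒞 T ] (λ C → ∏[ C ] φ) ≡ ∏[ T ] (λ n → ∑[ applyUpTo suc (value n) ] (λ r → φ (n , r)))
∑-∏-𝒞 φ []      = ℚ.+-identityʳ 1ℚ
∑-∏-𝒞 φ (n ∷ T) = begin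
  ∑[ 𝒞 (n ∷ T) ] (λ C → ∏[ C ] φ)
    ≡⟨ ∑-cartesianProductWith _ (λ C → ∏[ C ] φ) rs (𝒞 T) ⟩
  ∑[ rs ] (λ r → ∑[ 𝒞 T ] (λ C → φ (n , r) * ∏[ C ] φ))
    ≡⟨ ∑-cong (λ r → trans (∑-*ˡ (φ (n , r)) _ (𝒞 T)) (cong (φ (n , r) *_) (∑-∏-𝒞 φ T))) rs ⟩
  ∑[ rs ] (λ r → φ (n , r) * ∏[ T ] (λ n → ∑[ applyUpTo suc (value n) ] (λ r → φ (n , r))))
    ≡⟨ ∑-*ʳ _ (λ r → φ (n , r)) rs ⟩
  ∏[ n ∷ T ] (λ n → ∑[ applyUpTo suc (value n) ] (λ r → φ (n , r))) ∎
  where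
  open ≡-Reasoning
  rs = applyUpTo suc (value n)

inv-product : ∀ T → inv (product (map value T)) ≡ ∏[ T ] (inv ∘ value)
inv-product []      = refl
inv-product (n ∷ T) = trans (inv-* (value n) _) (cong (inv (value n) *_) (inv-product T))

-- Choosing C at random makes its residues independent.
average-∏ : ∀ (φ : ResidueClass → ℚ) T →
  average (λ C → ∏[ C ] φ) T ≡
  ∏[ T ] (λ n → inv (value n) * ∑[ applyUpTo suc (value n) ] (λ r → φ (n , r)))
average-∏ φ T = trans
  (cong₂ _*_ (trans (1/n≡inv (W T)) (trans (cong inv (W≡product T)) (inv-product T))) (∑-∏-𝒞 φ T))
  (sym (∏-* (inv ∘ value) (λ n → ∑[ applyUpTo suc (value n) ] (λ r → φ (n , r))) T))
  where instance _ = W≢0 T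

-- All systems therefore have the same period, the product of `T`, and their densities can be
-- computed over the same integers.
moduli : ∀ T → All (λ C → map proj₁ C ≡ T) (𝒞 T)
moduli []      = refl ∷ []
moduli (n ∷ T) = All.tabulate λ C∈ → case (∈-cartesianProductWith⁻ _ (applyUpTo suc (value n)) (𝒞 T) C∈)
  where
  case : ∀ {C} → _ → map proj₁ C ≡ n ∷ T
  case (r , C , _ , C∈𝒞T , refl) = cong (n ∷_) (All.lookup (moduli T) C∈𝒞T)

hit miss : ℕ → ResidueClass → ℚ
hit i c  = ⟦ ℤ.+ i ∈ᶜ? c ⟧
miss i c = 1ℚ - hit i c

⟦uncovered⟧ : ∀ C i → ⟦ uncovered? C (ℤ.+ i) ⟧ ≡ ∏[ C ] (miss i)
⟦uncovered⟧ []      i = refl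
⟦uncovered⟧ (c ∷ C) i with ℤ.+ i ∈ᶜ? c in eq
... | yes h = trans (⟦⟧≡0 (uncovered? (c ∷ C) (ℤ.+ i)) (λ { (¬h ∷ _) → ¬h h }))
                    (sym (trans (cong (λ d → (1ℚ - ⟦ d ⟧) * ∏[ C ] (miss i)) eq) (ℚ.*-zeroˡ (∏[ C ] (miss i)))))
... | no ¬h = trans (⟦⟧-cong (uncovered? (c ∷ C) (ℤ.+ i)) (uncovered? C (ℤ.+ i)) All.tail (¬h ∷_))
  (trans (⟦uncovered⟧ C i)
                    (sym (trans (cong (λ d → (1ℚ - ⟦ d ⟧) * ∏[ C ] (miss i)) eq) (ℚ.*-identityˡ (∏[ C ] (miss i))))))

δ≡ : ∀ C → δ C ≡ inv (period C) * ∑[ upTo (period C) ] (λ i → ∏[ C ] (miss i))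
δ≡ C = begin
  δ C
    -- By construction `δ C` is the witness of `periodic-density`: the uncovered count in one
    -- period, divided by the period.
    ≡⟨ m/n≡ (countUpTo (uncovered? C) ℤ.+_ (period C)) (period C) {{period≢0 C}} ⟩
  ι (countUpTo (uncovered? C) ℤ.+_ (period C)) * inv (period C)
    ≡⟨ ℚ.*-comm (ι (countUpTo (uncovered? C) ℤ.+_ (period C))) (inv (period C)) ⟩
  inv (period C) * ι (countUpTo (uncovered? C) ℤ.+_ (period C))
    ≡⟨ cong (inv (period C) *_) (trans (ι-length-filter (uncovered? C) (applyUpTo ℤ.+_ (period C)))
         (trans (∑-applyUpTo _ ℤ.+_ (period C)) (∑-cong (⟦uncovered⟧ C) (upTo (period C))))) ⟩
  inv (period C) * ∑[ upTo (period C) ] (λ i → ∏[ C ] (miss i)) ∎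
  where open ≡-Reasoning

avoid₂ : ℕ → ℕ → ℕ⁺ → ℚ
avoid₂ i j n = inv (value n) * ∑[ applyUpTo suc (value n) ] (λ r → miss j (n , r) * miss i (n , r))

recip≡inv : ∀ n → recip n ≡ inv (value n)
recip≡inv n = 1/n≡inv (value n)

∑-hit : ∀ n i → ∑[ applyUpTo suc (value n) ] (λ r → hit i (n , r)) ≡ 1ℚ
∑-hit n i = Multiples.∑-residues (value n) i

∑-miss : ∀ n i → ∑[ applyUpTo suc (value n) ] (λ r → miss i (n , r)) ≡ ι (value n) - 1ℚ
∑-miss n i = begin
  ∑[ rs ] (λ r → 1ℚ - hit i (n , r))
    ≡⟨ ∑-cong (λ r → solve 1 (λ h → con 1ℚ :- h := con 1ℚ :+ con (- 1ℚ) :* h) refl (hit i (n , r))) rs ⟩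
  ∑[ rs ] (λ r → 1ℚ + - 1ℚ * hit i (n , r))
    ≡⟨ trans (∑-+ (λ _ → 1ℚ) _ rs) (cong₂ _+_ (∑-const 1ℚ rs) (∑-*ˡ (- 1ℚ) _ rs)) ⟩
  ι (length rs) * 1ℚ + - 1ℚ * ∑[ rs ] (λ r → hit i (n , r))
    ≡⟨ cong₂ (λ l s → ι l * 1ℚ + - 1ℚ * s) (length-applyUpTo suc (value n)) (∑-hit n i) ⟩
  ι (value n) * 1ℚ + - 1ℚ * 1ℚ
    ≡⟨ cong (_+ - 1ℚ) (ℚ.*-identityʳ (ι (value n))) ⟩
  ι (value n) - 1ℚ ∎
  where
  open ≡-Reasoning
  rs = applyUpTo suc (value n)

-- The value is the same for every `i`, so the mean of `δ` is `α` and the quantity to bound is a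
-- genuine variance.
average-uncovered : ∀ T i → average (λ C → ∏[ C ] (miss i)) T ≡ α T
average-uncovered T i = trans (average-∏ (miss i) T) (∏-cong (λ n → begin
  inv (value n) * ∑[ applyUpTo suc (value n) ] (λ r → miss i (n , r))
    ≡⟨ cong (inv (value n) *_) (∑-miss n i) ⟩
  inv (value n) * (ι (value n) - 1ℚ)
    ≡⟨ solve 2 (λ i n → i :* (n :- con 1ℚ) := n :* i :- i) refl (inv (value n)) (ι (value n)) ⟩
  ι (value n) * inv (value n) - inv (value n)
    ≡⟨ cong₂ _-_ (ι*inv (value n)) (sym (recip≡inv n)) ⟩
  1ℚ - recip n ∎) T)
  where open ≡-Reasoning

-- Averages over one period, and the variance as a two-point average

module _ (P : ℕ) where

  mean : (ℕ → ℚ) → ℚ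
  mean f = inv P * ∑[ upTo P ] f

  mean-cong : ∀ {f g} → f ≗ g → mean f ≡ mean g
  mean-cong f≗g = cong (inv P *_) (∑-cong f≗g (upTo P))

  mean-mono : ∀ {f g} → (∀ i → f i ℚ.≤ g i) → mean f ℚ.≤ mean g
  mean-mono f≤g = *-monoˡ (inv P) (0≤inv P) (∑-mono′ f≤g (upTo P))

  mean-+ : ∀ f g → mean (λ i → f i + g i) ≡ mean f + mean g
  mean-+ f g = trans (cong (inv P *_) (∑-+ f g (upTo P))) (ℚ.*-distribˡ-+ (inv P) _ _)

  mean-*ˡ : ∀ c f → mean (λ i → c * f i) ≡ c * mean f
  mean-*ˡ c f = trans (cong (inv P *_) (∑-*ˡ c f (upTo P)))
    (solve 3 (λ p c s → p :* (c :* s) := c :* (p :* s)) refl (inv P) c (∑[ upTo P ] f))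

  mean-const : ∀ {{_ : ℕ.NonZero P}} c → mean (λ _ → c) ≡ c
  mean-const c = begin
    inv P * ∑[ upTo P ] (λ _ → c)    ≡⟨ cong (inv P *_) (∑-const c (upTo P)) ⟩
    inv P * (ι (length (upTo P)) * c) ≡⟨ cong (λ z → inv P * (ι z * c)) (length-applyUpTo id P) ⟩
    inv P * (ι P * c)                 ≡⟨ solve 3 (λ i p c → i :* (p :* c) := (p :* i) :* c) refl (inv P) (ι P) c ⟩
    (ι P * inv P) * c                 ≡⟨ trans (cong (_* c) (ι*inv P)) (ℚ.*-identityˡ c) ⟩
    c                                 ∎
    where open ≡-Reasoning

  mean-∑ : ∀ (f : A → ℕ → ℚ) xs → mean (λ i → ∑[ xs ] (λ x → f x i)) ≡ ∑[ xs ] (λ x → mean (f x))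
  mean-∑ f xs = trans (cong (inv P *_) (∑-swap (λ i x → f x i) (upTo P) xs)) (sym (∑-*ˡ (inv P) _ xs))

  average-mean : ∀ (f : ℕ → System → ℚ) T →
    average (λ C → mean (λ i → f i C)) T ≡ mean (λ i → average (f i) T)
  average-mean f T = trans (average-*ˡ (inv P) _ T) (cong (inv P *_) (average-∑ f (upTo P) T))

-- Squaring an average over one integer gives an average over pairs (i, j). Once the average over
-- systems is moved inside, independence of the residues splits the summand into one factor per
-- modulus.
variance≡ : ∀ T → let P = product (map value T) in
  average (λ C → ∣ δ C - α T ∣ ²) T ≡
  mean P (λ j → mean P (λ i → ∏[ T ] (avoid₂ i j))) - α T * α T
variance≡ T = begin
  average (λ C → ∣ δ C - a ∣ ²) T
    ≡⟨ average-cong {f = λ C → ∣ δ C - a ∣ ²} {g = λ C → square C + (- (a + a) * D C + a * a)}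
         {T = T} (All.map expand (moduli T)) ⟩
  average (λ C → square C + (- (a + a) * D C + a * a)) T
    ≡⟨ trans (average-+ square _ T) (cong (average square T +_)
         (trans (average-+ (λ C → - (a + a) * D C) _ T)
                (cong₂ _+_ (average-*ˡ (- (a + a)) D T) (average-const (a * a) T)))) ⟩
  average square T + (- (a + a) * average D T + a * a)
    ≡⟨ cong₂ (λ x y → x + (- (a + a) * y + a * a)) average-square average-D ⟩
  M + (- (a + a) * a + a * a)
    ≡⟨ solve 2 (λ m a → m :+ (:- (a :+ a) :* a :+ a :* a) := m :- a :* a) refl M a ⟩
  M - a * a ∎
  where
  open ≡-Reasoning
  P = product (map value T)
  a = α T
  U : ℕ → System → ℚ
  U i C = ∏[ C ] (miss i)
  D square : System → ℚ
  D C = mean P (λ i → U i C)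
  square C = mean P (λ j → mean P (λ i → ∏[ C ] (λ c → miss j c * miss i c)))
  M = mean P (λ j → mean P (λ i → ∏[ T ] (avoid₂ i j)))
  δ≡D : ∀ {C} → map proj₁ C ≡ T → δ C ≡ D C
  -- Matching on `refl` replaces `T` by the moduli of `C`, so `P` becomes `period C` up to fusing
  -- two maps.
  δ≡D {C} refl = trans (δ≡ C) (cong (λ z → inv z * ∑[ upTo z ] (λ i → U i C)) (cong product (map-∘ C)))
  D*D : ∀ C → D C * D C ≡ square C
  D*D C = begin
    D C * D C
      ≡⟨ mean-*ˡ P (D C) (λ j → U j C) ⟨
    mean P (λ j → D C * U j C)
      ≡⟨ mean-cong P (λ j → trans (ℚ.*-comm (D C) (U j C)) (sym (mean-*ˡ P (U j C) (λ i → U i C)))) ⟩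
    mean P (λ j → mean P (λ i → U j C * U i C))
      ≡⟨ mean-cong P (λ j → mean-cong P (λ i → ∏-* (miss j) (miss i) C)) ⟨
    square C ∎
  expand : ∀ {C} → map proj₁ C ≡ T → ∣ δ C - a ∣ ² ≡ square C + (- (a + a) * D C + a * a)
  expand {C} eq = begin
    ∣ δ C - a ∣ ²
      ≡⟨ ∣p∣²≡p² (δ C - a) ⟩
    (δ C - a) * (δ C - a)
      ≡⟨ cong (λ d → (d - a) * (d - a)) (δ≡D eq) ⟩
    (D C - a) * (D C - a)
      ≡⟨ solve 2 (λ d a → (d :- a) :* (d :- a) := d :* d :+ (:- (a :+ a) :* d :+ a :* a)) refl (D C) a ⟩
    D C * D C + (- (a + a) * D C + a * a)
      ≡⟨ cong (_+ (- (a + a) * D C + a * a)) (D*D C) ⟩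
    square C + (- (a + a) * D C + a * a) ∎
  average-square : average square T ≡ M
  average-square = trans (average-mean P (λ j C → mean P (λ i → ∏[ C ] (λ c → miss j c * miss i c))) T)
    (mean-cong P (λ j → trans (average-mean P (λ i C → ∏[ C ] (λ c → miss j c * miss i c)) T)
      (mean-cong P (λ i → average-∏ (λ c → miss j c * miss i c) T))))
  average-D : average D T ≡ a
  average-D = trans (average-mean P U T)
    (trans (mean-cong P (average-uncovered T)) (mean-const P a))
    where instance _ = subst ℕ.NonZero (W≡product T) (W≢0 T)

-- 1/n·#{r : both i and j avoid r mod n} is 1 − 2/n + [n ∣ i−j]/n, of which only ≤ is needed.
avoid₂-≤ : ∀ i j n → avoid₂ i j n ℚ.≤
  (1ℚ - (inv (value n) + inv (value n))) + inv (value n) * ⟦ ℤ.+ value n ∣? (ℤ.+ i ℤ.- ℤ.+ j) ⟧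
avoid₂-≤ i j n = begin
  inv v * ∑[ rs ] (λ r → miss j (n , r) * miss i (n , r))
    ≡⟨ cong (inv v *_) (∑-cong (λ r → solve 2 (λ x y → (con 1ℚ :- x) :* (con 1ℚ :- y)
         := (con 1ℚ :- y) :+ (con (- 1ℚ) :* x :+ x :* y)) refl (hit j (n , r)) (hit i (n , r))) rs) ⟩
  inv v * ∑[ rs ] (λ r → miss i (n , r) + (- 1ℚ * hit j (n , r) + hit j (n , r) * hit i (n , r)))
    ≡⟨ cong (inv v *_) (trans (∑-+ _ _ rs) (cong₂ _+_ (∑-miss n i)
         (trans (∑-+ _ _ rs) (cong₂ _+_ (trans (∑-*ˡ (- 1ℚ) _ rs) (cong (- 1ℚ *_) (∑-hit n j))) refl)))) ⟩
  inv v * ((ι v - 1ℚ) + (- 1ℚ * 1ℚ + ∑[ rs ] (λ r → hit j (n , r) * hit i (n , r))))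
    ≤⟨ *-monoˡ (inv v) (0≤inv v) (ℚ.+-monoʳ-≤ (ι v - 1ℚ) (ℚ.+-monoʳ-≤ (- 1ℚ) (both d))) ⟩
  inv v * ((ι v - 1ℚ) + (- 1ℚ + ⟦ d ⟧))
    ≡⟨ solve 3 (λ i v d → i :* ((v :- con 1ℚ) :+ (con (- 1ℚ) :+ d)) := (v :* i :- (i :+ i)) :+ i :* d)
         refl (inv v) (ι v) ⟦ d ⟧ ⟩
  (ι v * inv v - (inv v + inv v)) + inv v * ⟦ d ⟧
    ≡⟨ cong (λ z → (z - (inv v + inv v)) + inv v * ⟦ d ⟧) (ι*inv (value n)) ⟩
  (1ℚ - (inv v + inv v)) + inv v * ⟦ d ⟧ ∎
  where
  open ℚ.≤-Reasoning
  v = value n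
  rs = applyUpTo suc v
  d = ℤ.+ v ∣? (ℤ.+ i ℤ.- ℤ.+ j)
  -- If `n` divides `i − j`, the joint hits are bounded by the hits of `j`, of which there is one;
  -- otherwise a class containing both would force the divisibility.
  both : ∀ (d : Dec (ℤ.+ v ∣ ℤ.+ i ℤ.- ℤ.+ j)) → ∑[ rs ] (λ r → hit j (n , r) * hit i (n , r)) ℚ.≤ ⟦ d ⟧
  both (yes _) = ℚ.≤-trans (∑-mono′ (λ r → subst (hit j (n , r) * hit i (n , r) ℚ.≤_) (ℚ.*-identityʳ _)
                  (*-monoˡ (hit j (n , r)) (0≤⟦⟧ (ℤ.+ j ∈ᶜ? (n , r))) (⟦⟧≤1 (ℤ.+ i ∈ᶜ? (n , r))))) rs)
                  (ℚ.≤-reflexive (∑-hit n j))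
  both (no ¬d) = ℚ.≤-trans (∑-mono′ (λ r → ⟦⟧*⟦⟧≤ (ℤ.+ j ∈ᶜ? (n , r)) (ℤ.+ i ∈ᶜ? (n , r)) (no ¬d)
                  (λ x y → subst (ℤ.+ v ∣_) (difference (ℤ.+ i) (ℤ.+ j) (ℤ.+ r)) (ℤ.∣m∣n⇒∣m-n y x))) rs)
                  (ℚ.≤-reflexive (∑-0 rs))
    where
    difference : ∀ i j r → (i ℤ.- r) ℤ.- (j ℤ.- r) ≡ i ℤ.- j
    difference = ℤS.solve 3 (λ i j r → (i ℤS.:- r) ℤS.:- (j ℤS.:- r) ℤS.:= i ℤS.:- j) refl

-- The Weierstrass product inequality. It turns the averaged first-order sum back into a product,
-- which can be merged with ∏ (1 - 2/n) factor by factor.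
1+∑≤∏1+ : ∀ (f : A → ℚ) → (∀ x → 0ℚ ℚ.≤ f x) → ∀ xs → 1ℚ + ∑[ xs ] f ℚ.≤ ∏[ xs ] (λ x → 1ℚ + f x)
1+∑≤∏1+ f 0≤f []       = ℚ.≤-refl
1+∑≤∏1+ f 0≤f (x ∷ xs) = begin
  1ℚ + (f x + ∑[ xs ] f)
    ≤⟨ p≤p+q _ (0≤* (0≤f x) (∑-nonNeg 0≤f xs)) ⟩
  1ℚ + (f x + ∑[ xs ] f) + f x * ∑[ xs ] f
    ≡⟨ solve 2 (λ a s → con 1ℚ :+ (a :+ s) :+ a :* s := (con 1ℚ :+ a) :* (con 1ℚ :+ s)) refl (f x) (∑[ xs ] f) ⟩
  (1ℚ + f x) * (1ℚ + ∑[ xs ] f)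
    ≤⟨ *-monoˡ (1ℚ + f x) (0≤+ 0≤1 (0≤f x)) (1+∑≤∏1+ f 0≤f xs) ⟩
  ∏[ x ∷ xs ] (λ x → 1ℚ + f x) ∎
  where open ℚ.≤-Reasoning

-- The entry that comes earlier is the first argument of `q`; on decreasing lists this is the larger
-- one.
pairSum : (A → A → ℚ) → List A → ℚ
pairSum q []       = 0ℚ
pairSum q (x ∷ xs) = ∑[ xs ] (q x) + pairSum q xs

∑-pairSum : ∀ (q : B → A → A → ℚ) is xs →
  ∑[ is ] (λ i → pairSum (q i) xs) ≡ pairSum (λ x y → ∑[ is ] (λ i → q i x y)) xs
∑-pairSum q is []       = ∑-0 is
∑-pairSum q is (x ∷ xs) = trans (∑-+ (λ i → ∑[ xs ] (q i x)) _ is)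
  (cong₂ _+_ (∑-swap (λ i → q i x) is xs) (∑-pairSum q is xs))

pairSum-*ˡ : ∀ c (q : A → A → ℚ) xs → pairSum (λ x y → c * q x y) xs ≡ c * pairSum q xs
pairSum-*ˡ c q []       = sym (ℚ.*-zeroʳ c)
pairSum-*ˡ c q (x ∷ xs) = trans (cong₂ _+_ (∑-*ˡ c (q x) xs) (pairSum-*ˡ c q xs))
  (sym (ℚ.*-distribˡ-+ c (∑[ xs ] (q x)) (pairSum q xs)))

pairSum-mono : ∀ {q q′ : A → A → ℚ} {P : Pred A 0ℓ} {xs} → All P xs →
  (∀ {x y} → P x → P y → q x y ℚ.≤ q′ x y) → pairSum q xs ℚ.≤ pairSum q′ xs
pairSum-mono []       q≤q′ = ℚ.≤-refl
pairSum-mono (p ∷ ps) q≤q′ = ℚ.+-mono-≤ (∑-mono (All.map (q≤q′ p) ps)) (pairSum-mono ps q≤q′)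

-- The weight 1/(n-2), chosen because (1 - 2/n)/(n-2) = 1/n; it is used for n ≥ 3, where neither the
-- truncated subtraction nor the junk inverse intervenes.
ε : ℕ → ℚ
ε n = inv (n ℕ.∸ 2)

-- Pointwise expansion of ∏ (1 + eₙ/(n−2)) over a decreasing list

module _ (N : ℕ) (3≤N : 3 ≤ N) (e : ℕ → ℚ) (0≤e : ∀ n → 0ℚ ℚ.≤ e n) (e≤1 : ∀ n → e n ℚ.≤ 1ℚ) where

  private
    F : List ℕ → ℚ
    F ns = ∏[ ns ] (λ n → 1ℚ + ε n * e n)

    N∸2≢0 : ∀ {n} → N ≤ n → ℕ.NonZero (n ℕ.∸ 2)
    N∸2≢0 N≤n = ℕ.>-nonZero (ℕ.m<n⇒0<n∸m (ℕ.≤-trans 3≤N N≤n))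

    factor : ∀ n → 0ℚ ℚ.≤ 1ℚ + ε n * e n
    factor n = 0≤+ 0≤1 (0≤* (0≤inv (n ℕ.∸ 2)) (0≤e n))

    c = inv (N ℕ.∸ 2)
    0≤c = 0≤inv (N ℕ.∸ 2)

  -- The product telescopes: (1 + 1/(n−2)) (n−2) = n−1.
  ∏-growth : ∀ {M ns} → N ≤ M → All (λ n → N ≤ n) ns → All (λ n → n ℕ.< M) ns → AllPairs ℕ._>_ ns →
             F ns ℚ.≤ ι (M ℕ.∸ 2) * c
  ∏-growth {M} N≤M [] [] [] = ℚ.≤-trans (ℚ.≤-reflexive (sym (ι*inv (N ℕ.∸ 2) {{N∸2≢0 ℕ.≤-refl}})))
    (*-monoʳ c 0≤c (ι-mono (ℕ.∸-monoˡ-≤ 2 N≤M)))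
  ∏-growth {M} {n ∷ ns} N≤M (N≤n ∷ N≤ns) (n<M ∷ _) (ns<n ∷ dec) = begin
    (1ℚ + ε n * e n) * F ns
      ≤⟨ *-mono (factor n) (0≤* (0≤ι (n ℕ.∸ 2)) 0≤c)
           (ℚ.+-monoʳ-≤ 1ℚ (*-monoˡ (ε n) (0≤inv (n ℕ.∸ 2)) (e≤1 n))) (∏-growth N≤n N≤ns ns<n dec) ⟩
    (1ℚ + ε n * 1ℚ) * (ι (n ℕ.∸ 2) * c)
      ≡⟨ solve 3 (λ i n c → (con 1ℚ :+ i :* con 1ℚ) :* (n :* c) := (n :* i :+ n) :* c) refl (ε n) (ι (n ℕ.∸ 2)) c ⟩
    (ι (n ℕ.∸ 2) * ε n + ι (n ℕ.∸ 2)) * c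
      ≡⟨ cong (λ z → (z + ι (n ℕ.∸ 2)) * c) (ι*inv (n ℕ.∸ 2) {{N∸2≢0 N≤n}}) ⟩
    ι (suc (n ℕ.∸ 2)) * c
      ≤⟨ *-monoʳ c 0≤c (ι-mono (subst (_≤ M ℕ.∸ 2)
           (ℕ.+-∸-assoc 1 {n} {2} (ℕ.≤-trans (ℕ.n≤1+n 2) (ℕ.≤-trans 3≤N N≤n)))
           (ℕ.∸-monoˡ-≤ 2 n<M))) ⟩
    ι (M ℕ.∸ 2) * c ∎
    where open ℚ.≤-Reasoning

  -- Adding the largest modulus `n` increases the product by `ε n * e n` times the product over the
  -- rest. By `∏-growth` that rest is at most (n-2)c, so `ε n` cancels and the increase is at most
  -- `c * e n`.
  ∏≤1+∑ : ∀ {ns} → All (λ n → N ≤ n) ns → AllPairs ℕ._>_ ns → F ns ℚ.≤ 1ℚ + c * ∑[ ns ] e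
  ∏≤1+∑ [] [] = p≤p+q 1ℚ (0≤* 0≤c ℚ.≤-refl)
  ∏≤1+∑ {n ∷ ns} (N≤n ∷ N≤ns) (ns<n ∷ dec) = begin
    (1ℚ + ε n * e n) * F ns
      ≡⟨ solve 3 (λ i e f → (con 1ℚ :+ i :* e) :* f := f :+ i :* e :* f) refl (ε n) (e n) (F ns) ⟩
    F ns + ε n * e n * F ns
      ≤⟨ ℚ.+-mono-≤ (∏≤1+∑ N≤ns dec) (*-monoˡ (ε n * e n) (0≤* (0≤inv (n ℕ.∸ 2)) (0≤e n)) (∏-growth N≤n N≤ns ns<n dec)) ⟩
    1ℚ + c * ∑[ ns ] e + ε n * e n * (ι (n ℕ.∸ 2) * c)
      ≡⟨ solve 5 (λ c s i e m → con 1ℚ :+ c :* s :+ i :* e :* (m :* c) := con 1ℚ :+ (c :* s :+ (m :* i) :* (c :* e)))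
           refl c (∑[ ns ] e) (ε n) (e n) (ι (n ℕ.∸ 2)) ⟩
    1ℚ + (c * ∑[ ns ] e + (ι (n ℕ.∸ 2) * ε n) * (c * e n))
      ≡⟨ cong (λ z → 1ℚ + (c * ∑[ ns ] e + z * (c * e n))) (ι*inv (n ℕ.∸ 2) {{N∸2≢0 N≤n}}) ⟩
    1ℚ + (c * ∑[ ns ] e + 1ℚ * (c * e n))
      ≡⟨ solve 3 (λ c s e → con 1ℚ :+ (c :* s :+ con 1ℚ :* (c :* e)) := con 1ℚ :+ c :* (e :+ s)) refl c (∑[ ns ] e) (e n) ⟩
    1ℚ + c * ∑[ n ∷ ns ] e ∎
    where open ℚ.≤-Reasoning

  -- The same peeling, with the rest now bounded by `∏≤1+∑`: its 1 yields the exact first-order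
  -- term, its sum the pairs. The weight `ε` of the larger member of each pair survives, which later
  -- makes the pair sum converge.
  ∏≤1+∑+pairSum : ∀ {ns} → All (λ n → N ≤ n) ns → AllPairs ℕ._>_ ns →
    F ns ℚ.≤ 1ℚ + ∑[ ns ] (λ n → ε n * e n) + c * pairSum (λ m n → ε m * (e m * e n)) ns
  ∏≤1+∑+pairSum [] [] = p≤p+q 1ℚ (0≤* 0≤c ℚ.≤-refl)
  ∏≤1+∑+pairSum {n ∷ ns} (N≤n ∷ N≤ns) (ns<n ∷ dec) = begin
    (1ℚ + x) * F ns
      ≡⟨ solve 2 (λ x f → (con 1ℚ :+ x) :* f := f :+ x :* f) refl x (F ns) ⟩
    F ns + x * F ns
      ≤⟨ ℚ.+-mono-≤ (∏≤1+∑+pairSum N≤ns dec) (*-monoˡ x (0≤* (0≤inv (n ℕ.∸ 2)) (0≤e n)) (∏≤1+∑ N≤ns dec)) ⟩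
    1ℚ + s + c * t + x * (1ℚ + c * ∑[ ns ] e)
      ≡⟨ solve 5 (λ s c t x u → con 1ℚ :+ s :+ c :* t :+ x :* (con 1ℚ :+ c :* u)
           := con 1ℚ :+ (x :+ s) :+ c :* (x :* u :+ t)) refl s c t x (∑[ ns ] e) ⟩
    1ℚ + (x + s) + c * (x * ∑[ ns ] e + t)
      ≡⟨ cong (λ z → 1ℚ + (x + s) + c * (z + t))
           (trans (∑-cong (λ m → sym (ℚ.*-assoc (ε n) (e n) (e m))) ns) (∑-*ˡ x e ns)) ⟨
    1ℚ + (x + s) + c * (∑[ ns ] (λ m → ε n * (e n * e m)) + t) ∎
    where
    open ℚ.≤-Reasoning
    x = ε n * e n
    s = ∑[ ns ] (λ n → ε n * e n)
    t = pairSum (λ m n → ε m * (e m * e n)) ns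

-- The expansion averaged over a period

mean-pairSum : ∀ P (q : ℕ → A → A → ℚ) xs →
  mean P (λ i → pairSum (q i) xs) ≡ pairSum (λ x y → mean P (λ i → q i x y)) xs
mean-pairSum P q xs = trans (cong (inv P *_) (∑-pairSum q (upTo P) xs)) (sym (pairSum-*ˡ (inv P) _ xs))

module _ (P : ℕ) {{P≢0 : ℕ.NonZero P}} (j : ℕ) where

  divides : ℕ → ℕ → ℚ
  divides n i = ⟦ ℤ.+ n ∣? (ℤ.+ i ℤ.- ℤ.+ j) ⟧

  -- Exact and independent of `j`: since `L` divides `P`, any `P` consecutive integers contain P/L
  -- multiples of `L`.
  mean-divides : ∀ {L} → L ℕ.∣ P → mean P (divides L) ≡ inv L
  mean-divides {L} (ℕ.divides q eq) = begin
    inv P * ∑[ upTo P ] (divides L)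
      ≡⟨ cong (λ z → inv z * ∑[ upTo z ] (divides L)) eq ⟩
    inv (q ℕ.* L) * ∑[ upTo (q ℕ.* L) ] (divides L)
      ≡⟨ cong₂ _*_ (inv-* q L) (Multiples.∑-multiples L j q) ⟩
    inv q * inv L * ι q
      ≡⟨ solve 3 (λ i l q → i :* l :* q := (q :* i) :* l) refl (inv q) (inv L) (ι q) ⟩
    (ι q * inv q) * inv L
      ≡⟨ trans (cong (_* inv L) (ι*inv q)) (ℚ.*-identityˡ (inv L)) ⟩
    inv L ∎
    where
    open ≡-Reasoning
    instance
      q*L≢0 = subst ℕ.NonZero eq P≢0
      q≢0 = ℕ.m*n≢0⇒m≢0 q
      L≢0 = ℕ.m*n≢0⇒n≢0 q

  -- Divisibility by both forces divisibility by the lcm, which again divides `P`.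
  mean-divides² : ∀ {m n} → m ℕ.∣ P → n ℕ.∣ P → mean P (λ i → divides m i * divides n i) ℚ.≤ inv (lcm m n)
  mean-divides² {m} {n} m∣P n∣P = ℚ.≤-trans
    (mean-mono P (λ i → ⟦⟧*⟦⟧≤ (ℤ.+ m ∣? (ℤ.+ i ℤ.- ℤ.+ j)) (ℤ.+ n ∣? (ℤ.+ i ℤ.- ℤ.+ j)) (ℤ.+ lcm m n ∣? (ℤ.+ i ℤ.- ℤ.+ j))
      (λ m∣ n∣ → ℤ.∣ᵤ⇒∣ (lcm-least (ℤ.∣⇒∣ᵤ m∣) (ℤ.∣⇒∣ᵤ n∣)))))
    (ℚ.≤-reflexive (mean-divides (lcm-least m∣P n∣P)))

  module _ (N : ℕ) (3≤N : 3 ≤ N) {ns} (N≤ns : All (λ n → N ≤ n) ns) (dec : AllPairs ℕ._>_ ns)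
           (ns∣P : All (ℕ._∣ P) ns) where

    -- The relative error: the variance will be at most `a * a * Q`.
    Q : ℚ
    Q = inv (N ℕ.∸ 2) * pairSum (λ m n → ε m * inv (lcm m n)) ns

    0≤Q : 0ℚ ℚ.≤ Q
    0≤Q = 0≤* (0≤inv (N ℕ.∸ 2)) (0≤pairSum ns)
      where
      0≤pairSum : ∀ ns → 0ℚ ℚ.≤ pairSum (λ m n → ε m * inv (lcm m n)) ns
      0≤pairSum []       = ℚ.≤-refl
      0≤pairSum (n ∷ ns) = 0≤+ (∑-nonNeg (λ m → 0≤* (0≤inv (n ℕ.∸ 2)) (0≤inv (lcm n m))) ns) (0≤pairSum ns)

    mean-∏≤ : mean P (λ i → ∏[ ns ] (λ n → 1ℚ + ε n * divides n i)) ℚ.≤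
              1ℚ + ∑[ ns ] (λ n → ε n * inv n) + Q
    mean-∏≤ = begin
      mean P (λ i → ∏[ ns ] (λ n → 1ℚ + ε n * divides n i))
        ≤⟨ mean-mono P (λ i → ∏≤1+∑+pairSum N 3≤N (λ n → divides n i)
             (λ n → 0≤⟦⟧ (ℤ.+ n ∣? (ℤ.+ i ℤ.- ℤ.+ j))) (λ n → ⟦⟧≤1 (ℤ.+ n ∣? (ℤ.+ i ℤ.- ℤ.+ j))) N≤ns dec) ⟩
      mean P (λ i → 1ℚ + ∑[ ns ] (λ n → ε n * divides n i) + c * pairSum (q i) ns)
        ≡⟨ trans (mean-+ P (λ i → 1ℚ + ∑[ ns ] (λ n → ε n * divides n i)) _)
             (cong₂ _+_ (trans (mean-+ P (λ _ → 1ℚ) _)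
               (cong₂ _+_ (mean-const P 1ℚ) (trans (mean-∑ P (λ n i → ε n * divides n i) ns)
                 (∑-cong (λ n → mean-*ˡ P (ε n) (divides n)) ns))))
               (trans (mean-*ˡ P c _) (cong (c *_) (mean-pairSum P q ns)))) ⟩
      1ℚ + ∑[ ns ] (λ n → ε n * mean P (divides n)) + c * pairSum (λ m n → mean P (λ i → q i m n)) ns
        ≤⟨ ℚ.+-mono-≤ (ℚ.≤-reflexive (cong (1ℚ +_) (∑-cong-All (All.map (λ {n} n∣P → cong (ε n *_) (mean-divides n∣P)) ns∣P))))
             (*-monoˡ c (0≤inv (N ℕ.∸ 2)) (pairSum-mono ns∣P (λ {m} {n} m∣P n∣P →
               ℚ.≤-trans (ℚ.≤-reflexive (mean-*ˡ P (ε m) _)) (*-monoˡ (ε m) (0≤inv (m ℕ.∸ 2)) (mean-divides² m∣P n∣P))))) ⟩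
      1ℚ + ∑[ ns ] (λ n → ε n * inv n) + Q ∎
      where
      open ℚ.≤-Reasoning
      c = inv (N ℕ.∸ 2)
      q : ℕ → ℕ → ℕ → ℚ
      q i m n = ε m * (divides m i * divides n i)

    private
      b : ℕ → ℚ
      b n = 1ℚ - (inv n + inv n)

      b≡ : ∀ n → 3 ≤ n → b n ≡ ι (n ℕ.∸ 2) * inv n
      b≡ (suc zero)      (s≤s ())
      b≡ n@(suc (suc k)) _ = begin
        1ℚ - (inv n + inv n)
          ≡⟨ cong (_- (inv n + inv n)) (ι*inv n) ⟨
        (1ℚ + (1ℚ + ι k)) * inv n - (inv n + inv n)
          ≡⟨ solve 2 (λ k i → (con 1ℚ :+ (con 1ℚ :+ k)) :* i :- (i :+ i) := k :* i) refl (ι k) (inv n) ⟩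
        ι k * inv n ∎
        where open ≡-Reasoning

      -- This is what makes the two-point factor `b n + inv n * d` split as `b n * (1ℚ + ε n * d)`.
      b*ε : ∀ n → 3 ≤ n → b n * ε n ≡ inv n
      b*ε n 3≤n = begin
        b n * ε n                        ≡⟨ cong (_* ε n) (b≡ n 3≤n) ⟩
        ι (n ℕ.∸ 2) * inv n * ε n      ≡⟨ solve 3 (λ k i e → k :* i :* e := (k :* e) :* i) refl (ι (n ℕ.∸ 2)) (inv n) (ε n) ⟩
        (ι (n ℕ.∸ 2) * ε n) * inv n    ≡⟨ cong (_* inv n) (ι*inv (n ℕ.∸ 2) {{ℕ.>-nonZero (ℕ.m<n⇒0<n∸m 3≤n)}}) ⟩
        1ℚ * inv n                       ≡⟨ ℚ.*-identityˡ (inv n) ⟩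
        inv n                            ∎
        where open ≡-Reasoning

      3≤ns : All (3 ≤_) ns
      3≤ns = All.map (ℕ.≤-trans 3≤N) N≤ns

      0≤b : ∀ n → 3 ≤ n → 0ℚ ℚ.≤ b n
      0≤b n 3≤n = subst (0ℚ ℚ.≤_) (sym (b≡ n 3≤n)) (0≤* (0≤ι (n ℕ.∸ 2)) (0≤inv n))

      a = ∏[ ns ] (λ n → 1ℚ - inv n)
      B′ = ∏[ ns ] b

      0≤B : 0ℚ ℚ.≤ B′
      0≤B = ∏-nonNeg (All.map (λ {n} → 0≤b n) 3≤ns)

      square : ∀ n → (1ℚ - inv n) * (1ℚ - inv n) ≡ b n + inv n * inv n
      square n = solve 1 (λ i → (con 1ℚ :- i) :* (con 1ℚ :- i) := (con 1ℚ :- (i :+ i)) :+ i :* i) refl (inv n)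

      B≤a² : B′ ℚ.≤ a * a
      B≤a² = ℚ.≤-trans (∏-mono (All.map (λ {n} → 0≤b n) 3≤ns)
          (All.universal (λ n → subst (b n ℚ.≤_) (sym (square n)) (p≤p+q (b n) (p²-nonNeg (inv n)))) ns))
        (ℚ.≤-reflexive (∏-* (λ n → 1ℚ - inv n) (λ n → 1ℚ - inv n) ns))

      B*∏≡a² : B′ * ∏[ ns ] (λ n → 1ℚ + ε n * inv n) ≡ a * a
      B*∏≡a² = trans (sym (∏-* b (λ n → 1ℚ + ε n * inv n) ns))
        (trans (∏-cong-All (All.map (λ {n} 3≤n → trans (trans
                 (solve 3 (λ b e i → b :* (con 1ℚ :+ e :* i) := b :+ (b :* e) :* i) refl (b n) (ε n) (inv n))
                 (cong (λ z → b n + z * inv n) (b*ε n 3≤n))) (sym (square n))) 3≤ns))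
               (∏-* (λ n → 1ℚ - inv n) (λ n → 1ℚ - inv n) ns))

    -- With y = 1/(n(n−2)) one has (1 − 2/n)(1 + y) = (1 − 1/n)², so the first-order terms
    -- cost nothing: ∏ (1 − 2/n) (1 + ∑ y) ≤ a².
    mean-∏≤a²+a²Q : mean P (λ i → ∏[ ns ] (λ n → (1ℚ - (inv n + inv n)) + inv n * divides n i)) ℚ.≤
                     a * a + a * a * Q
    mean-∏≤a²+a²Q = begin
      mean P (λ i → ∏[ ns ] (λ n → b n + inv n * divides n i))
        ≡⟨ mean-cong P (λ i → trans (∏-cong-All (All.map (λ {n} 3≤n → trans
             (cong (λ z → b n + z * divides n i) (sym (b*ε n 3≤n)))
             (solve 3 (λ b e d → b :+ (b :* e) :* d := b :* (con 1ℚ :+ e :* d)) refl (b n) (ε n) (divides n i))) 3≤ns))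
             (∏-* b (λ n → 1ℚ + ε n * divides n i) ns)) ⟩
      mean P (λ i → B′ * ∏[ ns ] (λ n → 1ℚ + ε n * divides n i))
        ≡⟨ mean-*ˡ P B′ _ ⟩
      B′ * mean P (λ i → ∏[ ns ] (λ n → 1ℚ + ε n * divides n i))
        ≤⟨ *-monoˡ B′ 0≤B mean-∏≤ ⟩
      B′ * (1ℚ + ∑[ ns ] (λ n → ε n * inv n) + Q)
        ≤⟨ *-monoˡ B′ 0≤B (ℚ.+-monoˡ-≤ Q (1+∑≤∏1+ (λ n → ε n * inv n) (λ n → 0≤* (0≤inv (n ℕ.∸ 2)) (0≤inv n)) ns)) ⟩
      B′ * (∏[ ns ] (λ n → 1ℚ + ε n * inv n) + Q)
        ≡⟨ trans (ℚ.*-distribˡ-+ B′ _ Q) (cong (_+ B′ * Q) B*∏≡a²) ⟩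
      a * a + B′ * Q
        -- Only the error term takes the loss `B′ ≤ a²`; the main term is left as exactly `a * a`,
        -- to cancel in the variance.
        ≤⟨ ℚ.+-monoʳ-≤ (a * a) (*-monoʳ Q 0≤Q B≤a²) ⟩
      a * a + a * a * Q ∎
      where open ℚ.≤-Reasoning

-- From decreasing lists to intervals of integers

range : ℕ → ℕ → List ℕ
range a zero    = []
range a (suc k) = a ∷ range (suc a) k

range-≥ : ∀ a k → All (a ≤_) (range a k)
range-≥ a zero    = []
range-≥ a (suc k) = ℕ.≤-refl ∷ All.map ℕ.<⇒≤ (range-≥ (suc a) k)

range-< : ∀ a k → All (ℕ._< a ℕ.+ k) (range a k)
range-< a zero    = []
range-< a (suc k) = ℕ.m<m+n a ℕ.z<s ∷
  All.map (λ {n} → subst (n ℕ.<_) (sym (ℕ.+-suc a k))) (range-< (suc a) k)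

∑-range-+ : ∀ (f : ℕ → ℚ) a k l → ∑[ range a (k ℕ.+ l) ] f ≡ ∑[ range a k ] f + ∑[ range (a ℕ.+ k) l ] f
∑-range-+ f a zero    l = trans (cong (λ z → ∑[ range z l ] f) (sym (ℕ.+-identityʳ a))) (sym (ℚ.+-identityˡ _))
∑-range-+ f a (suc k) l = trans (cong (f a +_) (trans (∑-range-+ f (suc a) k l)
    (cong (λ z → ∑[ range (suc a) k ] f + ∑[ range z l ] f) (sym (ℕ.+-suc a k)))))
  (sym (ℚ.+-assoc (f a) _ _))

∑-range-∷ʳ : ∀ (f : ℕ → ℚ) a k → ∑[ range a (suc k) ] f ≡ ∑[ range a k ] f + f (a ℕ.+ k)
∑-range-∷ʳ f a k = trans (cong (λ z → ∑[ range a z ] f) (ℕ.+-comm 1 k))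
  (trans (∑-range-+ f a k 1) (cong (∑[ range a k ] f +_) (ℚ.+-identityʳ (f (a ℕ.+ k)))))

∑-range-mono : ∀ {f : ℕ → ℚ} → (∀ n → 0ℚ ℚ.≤ f n) → ∀ a {k l} → k ≤ l → ∑[ range a k ] f ℚ.≤ ∑[ range a l ] f
∑-range-mono 0≤f a {l = l} z≤n       = ∑-nonNeg 0≤f (range a l)
∑-range-mono {f} 0≤f a     (s≤s k≤l) = ℚ.+-monoʳ-≤ (f a) (∑-range-mono 0≤f (suc a) k≤l)

term≤∑-range : ∀ {f : ℕ → ℚ} → (∀ n → 0ℚ ℚ.≤ f n) → ∀ a k {n} → a ≤ n → n ℕ.< a ℕ.+ k → f n ℚ.≤ ∑[ range a k ] f
term≤∑-range {f} 0≤f a k {n} a≤n n<a+k = begin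
  f n                                  ≡⟨ cong f (ℕ.m+[n∸m]≡n a≤n) ⟨
  f (a ℕ.+ (n ℕ.∸ a))                 ≤⟨ p≤q+p (∑-nonNeg 0≤f (range a (n ℕ.∸ a))) ⟩
  ∑[ range a (n ℕ.∸ a) ] f + f (a ℕ.+ (n ℕ.∸ a)) ≡⟨ ∑-range-∷ʳ f a (n ℕ.∸ a) ⟨
  ∑[ range a (suc (n ℕ.∸ a)) ] f      ≤⟨ ∑-range-mono 0≤f a (offset a≤n n<a+k) ⟩
  ∑[ range a k ] f                     ∎
  where
  open ℚ.≤-Reasoning
  offset : a ≤ n → n ℕ.< a ℕ.+ k → n ℕ.∸ a ℕ.< k
  offset a≤n n<a+k = ℕ.+-cancelˡ-< a _ _ (subst (ℕ._< a ℕ.+ k) (sym (ℕ.m+[n∸m]≡n a≤n)) n<a+k)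

∑-decreasing : ∀ {f : ℕ → ℚ} → (∀ n → 0ℚ ℚ.≤ f n) → ∀ {a ns} k →
  All (a ≤_) ns → All (ℕ._< a ℕ.+ k) ns → AllPairs ℕ._>_ ns → ∑[ ns ] f ℚ.≤ ∑[ range a k ] f
∑-decreasing 0≤f {a} k [] [] [] = ∑-nonNeg 0≤f (range a k)
∑-decreasing {f} 0≤f {a} {n ∷ ns} k (a≤n ∷ a≤ns) (n<a+k ∷ _) (ns<n ∷ dec)
  -- Write n = a + b. As the list decreases, its tail lies in a, ..., a + b - 1, and `n` is the next
  -- integer.
  with n ℕ.∸ a | ℕ.m+[n∸m]≡n a≤n
... | b | refl = begin
  f (a ℕ.+ b) + ∑[ ns ] f              ≤⟨ ℚ.+-monoʳ-≤ (f (a ℕ.+ b)) (∑-decreasing 0≤f b a≤ns ns<n dec) ⟩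
  f (a ℕ.+ b) + ∑[ range a b ] f       ≡⟨ trans (ℚ.+-comm (f (a ℕ.+ b)) _) (sym (∑-range-∷ʳ f a b)) ⟩
  ∑[ range a (suc b) ] f                ≤⟨ ∑-range-mono 0≤f a (ℕ.+-cancelˡ-< a b k n<a+k) ⟩
  ∑[ range a k ] f                      ∎
  where open ℚ.≤-Reasoning

-- ∑ q n m over a ≤ m < n < a + k, grouped by the smaller index; pairSum groups by the larger one.
triangle : (ℕ → ℕ → ℚ) → ℕ → ℕ → ℚ
triangle q a zero    = 0ℚ
triangle q a (suc k) = ∑[ range (suc a) k ] (λ n → q n a) + triangle q (suc a) k

-- A new largest index adds its pairs with all smaller ones. This is the exchange of summation
-- between the two groupings.
triangle-∷ʳ : ∀ q a k → triangle q a (suc k) ≡ triangle q a k + ∑[ range a k ] (q (a ℕ.+ k))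
triangle-∷ʳ q a zero    = refl
triangle-∷ʳ q a (suc k) = begin
  ∑[ range (suc a) (suc k) ] (λ n → q n a) + triangle q (suc a) (suc k)
    ≡⟨ cong₂ _+_ (∑-range-∷ʳ (λ n → q n a) (suc a) k) (triangle-∷ʳ q (suc a) k) ⟩
  ∑[ range (suc a) k ] (λ n → q n a) + q (suc a ℕ.+ k) a + (triangle q (suc a) k + ∑[ range (suc a) k ] (q (suc a ℕ.+ k)))
    ≡⟨ solve 4 (λ s x t u → s :+ x :+ (t :+ u) := s :+ t :+ (x :+ u)) refl
         (∑[ range (suc a) k ] (λ n → q n a)) (q (suc a ℕ.+ k) a) (triangle q (suc a) k) (∑[ range (suc a) k ] (q (suc a ℕ.+ k))) ⟩
  triangle q a (suc k) + ∑[ range a (suc k) ] (q (suc a ℕ.+ k))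
    ≡⟨ cong (λ z → triangle q a (suc k) + ∑[ range a (suc k) ] (q z)) (ℕ.+-suc a k) ⟨
  triangle q a (suc k) + ∑[ range a (suc k) ] (q (a ℕ.+ suc k)) ∎
  where open ≡-Reasoning

0≤triangle : ∀ {q} → (∀ n m → 0ℚ ℚ.≤ q n m) → ∀ a k → 0ℚ ℚ.≤ triangle q a k
0≤triangle 0≤q a zero    = ℚ.≤-refl
0≤triangle 0≤q a (suc k) = 0≤+ (∑-nonNeg (λ n → 0≤q n a) (range (suc a) k)) (0≤triangle 0≤q (suc a) k)

triangle-mono : ∀ {q} → (∀ n m → 0ℚ ℚ.≤ q n m) → ∀ a {k l} → k ≤ l → triangle q a k ℚ.≤ triangle q a l
triangle-mono 0≤q a {l = l} z≤n   = 0≤triangle 0≤q a l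
triangle-mono 0≤q a     (s≤s k≤l) =
  ℚ.+-mono-≤ (∑-range-mono (λ n → 0≤q n a) (suc a) k≤l) (triangle-mono 0≤q (suc a) k≤l)

pairSum≤triangle : ∀ {q : ℕ → ℕ → ℚ} → (∀ n m → 0ℚ ℚ.≤ q n m) → ∀ {a ns} k →
  All (a ≤_) ns → All (ℕ._< a ℕ.+ k) ns → AllPairs ℕ._>_ ns → pairSum q ns ℚ.≤ triangle q a k
pairSum≤triangle 0≤q {a} k [] [] [] = 0≤triangle 0≤q a k
pairSum≤triangle {q} 0≤q {a} {n ∷ ns} k (a≤n ∷ a≤ns) (n<a+k ∷ _) (ns<n ∷ dec)
  with n ℕ.∸ a | ℕ.m+[n∸m]≡n a≤n
... | b | refl = begin
  ∑[ ns ] (q (a ℕ.+ b)) + pairSum q ns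
    ≤⟨ ℚ.+-mono-≤ (∑-decreasing (0≤q (a ℕ.+ b)) b a≤ns ns<n dec) (pairSum≤triangle 0≤q b a≤ns ns<n dec) ⟩
  ∑[ range a b ] (q (a ℕ.+ b)) + triangle q a b
    ≡⟨ trans (ℚ.+-comm _ (triangle q a b)) (sym (triangle-∷ʳ q a b)) ⟩
  triangle q a (suc b)
    ≤⟨ triangle-mono 0≤q a (ℕ.+-cancelˡ-< a b k n<a+k) ⟩
  triangle q a k ∎
  where open ℚ.≤-Reasoning

-- The cap `G` is carried along because the row bound to be inserted counts divisors only up to a
-- fixed limit.
triangle≤∑ : ∀ (q : ℕ → ℕ → ℚ) (h : ℕ → ℚ) G a k → 1 ≤ a → a ℕ.+ k ≤ G →
  (∀ l j → 1 ≤ l → l ≤ G → ∑[ range (suc l) j ] (λ n → q n l) ℚ.≤ h l) →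
  triangle q a k ℚ.≤ ∑[ range a k ] h
triangle≤∑ q h G a zero    1≤a a+k≤G row = ℚ.≤-refl
triangle≤∑ q h G a (suc k) 1≤a a+k≤G row = ℚ.+-mono-≤
  (row a k 1≤a (ℕ.≤-trans (ℕ.m≤m+n a (suc k)) a+k≤G))
  (triangle≤∑ q h G (suc a) k (ℕ.m≤n⇒m≤1+n 1≤a) (subst (_≤ G) (ℕ.+-suc a k) a+k≤G) row)

-- Sums of 1/n² over multiples

inv² : ℕ → ℚ
inv² n = inv n * inv n

0≤inv² : ∀ n → 0ℚ ℚ.≤ inv² n
0≤inv² n = p²-nonNeg (inv n)

-- Bounds ∑_{b>a} 1/b².
tail : ℕ → ℚ
tail zero    = ι 2
tail (suc a) = inv (suc a)

0≤tail : ∀ a → 0ℚ ℚ.≤ tail a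
0≤tail zero    = 0≤ι 2
0≤tail (suc a) = 0≤inv (suc a)

inv-suc : ∀ b .{{_ : ℕ.NonZero b}} → inv (suc b) + inv (suc b) * inv b ≡ inv b
inv-suc b = begin
  inv (suc b) + inv (suc b) * inv b
    ≡⟨ cong (_+ inv (suc b) * inv b) (ℚ.*-identityʳ (inv (suc b))) ⟨
  inv (suc b) * 1ℚ + inv (suc b) * inv b
    ≡⟨ cong (λ z → inv (suc b) * z + inv (suc b) * inv b) (ι*inv b) ⟨
  inv (suc b) * (ι b * inv b) + inv (suc b) * inv b
    ≡⟨ solve 3 (λ s n b → s :* (n :* b) :+ s :* b := ((con 1ℚ :+ n) :* s) :* b) refl (inv (suc b)) (ι b) (inv b) ⟩
  (ι (suc b) * inv (suc b)) * inv b
    ≡⟨ trans (cong (_* inv b) (ι*inv (suc b))) (ℚ.*-identityˡ (inv b)) ⟩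
  inv b ∎
  where open ≡-Reasoning

-- For a ≥ 1 this is 1/b² ≤ 1/(b-1) - 1/b together with monotonicity, which allows `b` to skip
-- values. For a = 0 the value 2 absorbs 1/b² ≤ 1 and 1/b ≤ 1.
tail-step : ∀ {a b} → a ℕ.< b → inv² b + tail b ℚ.≤ tail a
tail-step {zero} {suc b} _ = begin
  inv² (suc b) + inv (suc b) ≤⟨ ℚ.+-mono-≤ (*-mono (0≤inv (suc b)) 0≤1 inv≤1 inv≤1) inv≤1 ⟩
  1ℚ * 1ℚ + 1ℚ               ≡⟨⟩
  ι 2                         ∎
  where
  open ℚ.≤-Reasoning
  inv≤1 = inv-antitone {1} {suc b} (s≤s z≤n)
tail-step {suc a} {suc b@(suc _)} (s≤s a<b) = begin
  inv (suc b) * inv (suc b) + inv (suc b) ≤⟨ ℚ.+-monoˡ-≤ (inv (suc b))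
    (*-monoˡ (inv (suc b)) (0≤inv (suc b)) (inv-antitone (ℕ.n≤1+n b))) ⟩
  inv (suc b) * inv b + inv (suc b)       ≡⟨ trans (ℚ.+-comm _ (inv (suc b))) (inv-suc b) ⟩
  inv b                                   ≤⟨ inv-antitone a<b ⟩
  inv (suc a)                             ∎
  where open ℚ.≤-Reasoning

[_∣_] : ℕ → ℕ → ℚ
[ g ∣ n ] = ⟦ g ℕ.∣? n ⟧

-- Multiples n = gb contribute 1/(g²b²). The induction runs through all integers after `x`; `a`
-- stays put between multiples, as only `g * a ≤ x` is required, and jumps to `b` at each multiple
-- met.
∑-multiples-inv² : ∀ g .{{_ : ℕ.NonZero g}} a x k → g ℕ.* a ≤ x →
  ∑[ range (suc x) k ] (λ n → [ g ∣ n ] * inv² n) ℚ.≤ inv² g * tail a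
∑-multiples-inv² g a x zero    ga≤x = 0≤* (0≤inv² g) (0≤tail a)
∑-multiples-inv² g a x (suc k) ga≤x = bound (g ℕ.∣? suc x)
  where
  open ℚ.≤-Reasoning
  rest = ∑[ range (suc (suc x)) k ] (λ n → [ g ∣ n ] * inv² n)

  bound : (d : Dec (g ℕ.∣ suc x)) → ⟦ d ⟧ * inv² (suc x) + rest ℚ.≤ inv² g * tail a
  bound (no _) = begin
    0ℚ * inv² (suc x) + rest ≡⟨ trans (cong (_+ rest) (ℚ.*-zeroˡ (inv² (suc x)))) (ℚ.+-identityˡ rest) ⟩
    rest                      ≤⟨ ∑-multiples-inv² g a (suc x) k (ℕ.m≤n⇒m≤1+n ga≤x) ⟩
    inv² g * tail a          ∎
  bound (yes (ℕ.divides b eq)) = begin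
    1ℚ * inv² (suc x) + rest
      ≤⟨ ℚ.+-mono-≤ (ℚ.≤-reflexive (trans (ℚ.*-identityˡ (inv² (suc x)))
           (trans (cong inv² eq) (cong₂ _*_ (inv-* b g) (inv-* b g)))))
           (∑-multiples-inv² g b (suc x) k (ℕ.≤-reflexive (trans (ℕ.*-comm g b) (sym eq)))) ⟩
    inv b * inv g * (inv b * inv g) + inv² g * tail b
      ≡⟨ solve 3 (λ b g t → b :* g :* (b :* g) :+ g :* g :* t := g :* g :* (b :* b :+ t)) refl (inv b) (inv g) (tail b) ⟩
    inv² g * (inv² b + tail b)
      ≤⟨ *-monoˡ (inv² g) (0≤inv² g) (tail-step a<b) ⟩
    inv² g * tail a ∎
    where
    a<b : a ℕ.< b
    a<b = ℕ.*-cancelˡ-< g a b (ℕ.≤-trans (s≤s ga≤x) (ℕ.≤-reflexive (trans eq (ℕ.*-comm b g))))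

-- Gcd sums and the divisor function

module _ (G : ℕ) where

  -- The divisor function d(l) for 1 ≤ l ≤ G. One cut-off for all `l` allows the sums over `l` and
  -- `g` to be exchanged.
  divisors : ℕ → ℚ
  divisors l = ∑[ range 1 G ] (λ g → [ g ∣ l ])

  -- The single term `g = gcd n l` suffices. The gain is that each term separates into a condition
  -- on `l` and one on `n`.
  ι-gcd≤ : ∀ n l → 1 ≤ l → l ≤ G → ι (gcd n l) ℚ.≤ ∑[ range 1 G ] (λ g → [ g ∣ l ] * ι g * [ g ∣ n ])
  ι-gcd≤ n l 1≤l l≤G = ℚ.≤-trans
    (ℚ.≤-reflexive (sym (trans (cong₂ (λ x y → x * ι (gcd n l) * y)
        (⟦⟧≡1 (gcd n l ℕ.∣? l) (gcd[m,n]∣n n l)) (⟦⟧≡1 (gcd n l ℕ.∣? n) (gcd[m,n]∣m n l)))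
      (trans (ℚ.*-identityʳ _) (ℚ.*-identityˡ (ι (gcd n l)))))))
    (term≤∑-range (λ g → 0≤* (0≤* (0≤⟦⟧ (g ℕ.∣? l)) (0≤ι g)) (0≤⟦⟧ (g ℕ.∣? n))) 1 G
      (ℕ.n≢0⇒n>0 (gcd[m,n]≢0 n l (inj₂ (ℕ.>⇒≢ 1≤l))))
      (s≤s (ℕ.≤-trans (ℕ.∣⇒≤ {{ℕ.>-nonZero 1≤l}} (gcd[m,n]∣n n l)) l≤G)))

  -- gcd(n,l) is at most the sum of the common divisors, and each divisor g of l contributes
  -- g·∑_{n>l, g∣n} 1/n² ≤ 1/l.
  ∑-gcd-inv² : ∀ l k → 1 ≤ l → l ≤ G →
    ∑[ range (suc l) k ] (λ n → ι (gcd n l) * inv² n) ℚ.≤ inv l * divisors l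
  ∑-gcd-inv² l k 1≤l l≤G = begin
    ∑[ ns ] (λ n → ι (gcd n l) * inv² n)
      ≤⟨ ∑-mono′ (λ n → *-monoʳ (inv² n) (0≤inv² n) (ι-gcd≤ n l 1≤l l≤G)) ns ⟩
    ∑[ ns ] (λ n → ∑[ gs ] (λ g → [ g ∣ l ] * ι g * [ g ∣ n ]) * inv² n)
      ≡⟨ trans (∑-cong (λ n → sym (∑-*ʳ (inv² n) _ gs)) ns) (∑-swap _ ns gs) ⟩
    ∑[ gs ] (λ g → ∑[ ns ] (λ n → [ g ∣ l ] * ι g * [ g ∣ n ] * inv² n))
      ≡⟨ ∑-cong (λ g → trans (∑-cong (λ n → ℚ.*-assoc ([ g ∣ l ] * ι g) _ _) ns) (∑-*ˡ ([ g ∣ l ] * ι g) _ ns)) gs ⟩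
    ∑[ gs ] (λ g → [ g ∣ l ] * ι g * ∑[ ns ] (λ n → [ g ∣ n ] * inv² n))
      ≤⟨ ∑-mono (All.map (λ {g} 1≤g → contribution g {{ℕ.>-nonZero 1≤g}} (g ℕ.∣? l)) (range-≥ 1 G)) ⟩
    ∑[ gs ] (λ g → inv l * [ g ∣ l ])
      ≡⟨ ∑-*ˡ (inv l) _ gs ⟩
    inv l * divisors l ∎
    where
    open ℚ.≤-Reasoning
    ns = range (suc l) k
    gs = range 1 G
    contribution : ∀ g .{{_ : ℕ.NonZero g}} (d : Dec (g ℕ.∣ l)) →
      ⟦ d ⟧ * ι g * ∑[ ns ] (λ n → [ g ∣ n ] * inv² n) ℚ.≤ inv l * ⟦ d ⟧
    contribution g (no _) = ℚ.≤-reflexive (solve 3 (λ g s l → con 0ℚ :* g :* s := l :* con 0ℚ) refl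
      (ι g) (∑[ ns ] (λ n → [ g ∣ n ] * inv² n)) (inv l))
    contribution g (yes (ℕ.divides zero eq)) = contradiction eq (ℕ.>⇒≢ 1≤l)
    -- With l = qg the multiples beyond `l` have cofactor above `q`; as `q` is a successor, `tail q`
    -- computes to `inv q`.
    contribution g (yes (ℕ.divides q@(suc _) eq)) = begin
      1ℚ * ι g * ∑[ ns ] (λ n → [ g ∣ n ] * inv² n)
        ≤⟨ *-monoˡ (1ℚ * ι g) (0≤* 0≤1 (0≤ι g)) (∑-multiples-inv² g q l k (ℕ.≤-reflexive (trans (ℕ.*-comm g q) (sym eq)))) ⟩
      1ℚ * ι g * (inv g * inv g * inv q)
        ≡⟨ solve 3 (λ n i q → con 1ℚ :* n :* (i :* i :* q) := (n :* i) :* (q :* i)) refl (ι g) (inv g) (inv q) ⟩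
      (ι g * inv g) * (inv q * inv g)
        ≡⟨ cong₂ _*_ (ι*inv g) (trans (sym (inv-* q g)) (cong inv (sym eq))) ⟩
      1ℚ * inv l
        ≡⟨ ℚ.*-comm 1ℚ (inv l) ⟩
      inv l * 1ℚ ∎

inv≤c*inv : ∀ c {m n} .{{_ : ℕ.NonZero c}} .{{_ : ℕ.NonZero n}} → n ≤ c ℕ.* m → inv m ℚ.≤ ι c * inv n
inv≤c*inv c {m} {n} n≤cm = begin
  inv m                    ≡⟨ trans (cong (_* inv m) (ι*inv c)) (ℚ.*-identityˡ (inv m)) ⟨
  (ι c * inv c) * inv m    ≡⟨ trans (ℚ.*-assoc (ι c) (inv c) (inv m)) (cong (ι c *_) (sym (inv-* c m))) ⟩
  ι c * inv (c ℕ.* m)     ≤⟨ *-monoˡ (ι c) (0≤ι c) (inv-antitone n≤cm) ⟩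
  ι c * inv n              ∎
  where open ℚ.≤-Reasoning

m<n+[m/n]*n : ∀ m n .{{_ : ℕ.NonZero n}} → m ℕ.< n ℕ.+ m / n ℕ.* n
m<n+[m/n]*n m n = subst (ℕ._< n ℕ.+ m / n ℕ.* n) (sym (m≡m%n+[m/n]*n m n)) (ℕ.+-monoˡ-< (m / n ℕ.* n) (m%n<n m n))

-- Exchange the sums over l and its divisors g, and split at g = N.
∑-divisors-inv² : ∀ x m k → 1 ≤ x →
  ∑[ range (suc x) k ] (λ l → inv l * (inv l * divisors (x ℕ.+ m) l)) ℚ.≤
  ι 2 * inv (suc x) * ∑[ range 1 x ] inv + ι 4 * inv (suc x)
∑-divisors-inv² x m k 1≤x = begin
  ∑[ ls ] (λ l → inv l * (inv l * divisors (x ℕ.+ m) l))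
    ≡⟨ ∑-cong (λ l → trans (solve 2 (λ i d → i :* (i :* d) := d :* (i :* i)) refl (inv l) (divisors (x ℕ.+ m) l))
         (sym (∑-*ʳ (inv² l) _ (range 1 (x ℕ.+ m))))) ls ⟩
  ∑[ ls ] (λ l → ∑[ range 1 (x ℕ.+ m) ] (λ g → [ g ∣ l ] * inv² l))
    ≡⟨ trans (∑-swap _ ls (range 1 (x ℕ.+ m))) (∑-range-+ S 1 x m) ⟩
  ∑[ range 1 x ] S + ∑[ range (suc x) m ] S
    ≤⟨ ℚ.+-mono-≤ small large ⟩
  ι 2 * inv (suc x) * ∑[ range 1 x ] inv + ι 4 * inv (suc x) ∎
  where
  open ℚ.≤-Reasoning
  instance _ = ℕ.>-nonZero 1≤x
  ls = range (suc x) k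
  S : ℕ → ℚ
  S g = ∑[ ls ] (λ l → [ g ∣ l ] * inv² l)

  -- With a = ⌊x/g⌋ ≥ 1 the sum over multiples is at most 1/(g²a), and x + 1 ≤ g + ag ≤ 2ag turns
  -- 1/(ag) into 2/(x+1).
  S≤ : ∀ g → 1 ≤ g → g ℕ.< suc x → S g ℚ.≤ ι 2 * inv (suc x) * inv g
  S≤ g@(suc _) 1≤g (s≤s g≤x) with x / g | m/n*n≤m x g | m<n+[m/n]*n x g | m≥n⇒m/n>0 {x} {g} g≤x
  ... | a@(suc _) | ag≤x | x<g+ag | _ = begin
    S g
      ≤⟨ ∑-multiples-inv² g a x k (ℕ.≤-trans (ℕ.≤-reflexive (ℕ.*-comm g a)) ag≤x) ⟩
    inv g * inv g * inv a
      ≡⟨ trans (solve 2 (λ g a → g :* g :* a := (a :* g) :* g) refl (inv g) (inv a)) (cong (_* inv g) (sym (inv-* a g))) ⟩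
    inv (a ℕ.* g) * inv g
      ≤⟨ *-monoʳ (inv g) (0≤inv g) (inv≤c*inv 2 {a ℕ.* g} {suc x} (ℕ.≤-trans x<g+ag
           (subst (g ℕ.+ a ℕ.* g ≤_)
             (cong (a ℕ.* g ℕ.+_) (sym (ℕ.+-identityʳ (a ℕ.* g))))
             (ℕ.+-monoˡ-≤ (a ℕ.* g) (ℕ.m≤n*m g a))))) ⟩
    ι 2 * inv (suc x) * inv g ∎

  small : ∑[ range 1 x ] S ℚ.≤ ι 2 * inv (suc x) * ∑[ range 1 x ] inv
  small = ℚ.≤-trans
    (∑-mono (All.zipWith (λ {g} (1≤g , g<) → S≤ g 1≤g g<) (range-≥ 1 x , range-< 1 x)))
    (ℚ.≤-reflexive (∑-*ˡ (ι 2 * inv (suc x)) inv (range 1 x)))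

  tail≡inv : ∀ y → 1 ≤ y → tail y ≡ inv y
  tail≡inv (suc y) _ = refl

  large : ∑[ range (suc x) m ] S ℚ.≤ ι 4 * inv (suc x)
  large = begin
    ∑[ range (suc x) m ] S
      ≤⟨ ∑-mono (All.map (λ {g} x<g → ∑-multiples-inv² g {{ℕ.>-nonZero (ℕ.≤-trans (s≤s z≤n) x<g)}} 0 x k
           (ℕ.≤-trans (ℕ.≤-reflexive (ℕ.*-zeroʳ g)) z≤n)) (range-≥ (suc x) m)) ⟩
    ∑[ range (suc x) m ] (λ g → inv² g * ι 2)
      ≡⟨ ∑-*ʳ (ι 2) inv² (range (suc x) m) ⟩
    ∑[ range (suc x) m ] inv² * ι 2
      -- Every integer is a multiple of 1, so the bound for multiples also sums `inv²` itself.
      ≡⟨ cong (_* ι 2) (∑-cong (λ n → trans (cong (_* inv² n) (⟦⟧≡1 (1 ℕ.∣? n) (ℕ.1∣ n))) (ℚ.*-identityˡ (inv² n)))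
           (range (suc x) m)) ⟨
    ∑[ range (suc x) m ] (λ n → [ 1 ∣ n ] * inv² n) * ι 2
      ≤⟨ *-monoʳ (ι 2) (0≤ι 2) (∑-multiples-inv² 1 x x m (ℕ.≤-reflexive (ℕ.*-identityˡ x))) ⟩
    1ℚ * tail x * ι 2
      ≡⟨ cong (_* ι 2) (trans (ℚ.*-identityˡ (tail x)) (tail≡inv x 1≤x)) ⟩
    inv x * ι 2
      ≤⟨ *-monoʳ (ι 2) (0≤ι 2) (inv≤c*inv 2 {x} {suc x}
           (ℕ.≤-trans (ℕ.+-monoˡ-≤ x 1≤x) (ℕ.≤-reflexive (cong (x ℕ.+_) (sym (ℕ.+-identityʳ x)))))) ⟩
    ι 2 * inv (suc x) * ι 2
      ≡⟨ solve 1 (λ i → con (ι 2) :* i :* con (ι 2) := con (ι 4) :* i) refl (inv (suc x)) ⟩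
    ι 4 * inv (suc x) ∎

-- The pair sum against the Riemann sums of log N

ε≤3*inv : ∀ n → 3 ≤ n → ε n ℚ.≤ ι 3 * inv n
-- n ≤ 3(n-2), with equality at n = 3.
ε≤3*inv n@(suc (suc k)) (s≤s (s≤s 1≤k)) = inv≤c*inv 3 {k} {n} (begin
  2 ℕ.+ k             ≤⟨ ℕ.+-monoˡ-≤ k (ℕ.*-monoʳ-≤ 2 1≤k) ⟩
  2 ℕ.* k ℕ.+ k      ≡⟨ ℕ.+-comm (2 ℕ.* k) k ⟩
  3 ℕ.* k             ∎)
  where open ℕ.≤-Reasoning

-- Uses 1/lcm = gcd/(mn). In the application `n` is the smaller index; with `inv n` split off, the
-- sum over `m` is that of `∑-gcd-inv²`.
ε*inv-lcm≤ : ∀ m n → 3 ≤ m → 3 ≤ n →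
  ε m * inv (lcm m n) ℚ.≤ ι 3 * (inv n * (ι (gcd m n) * inv² m))
ε*inv-lcm≤ m n 3≤m 3≤n = begin
  ε m * inv (lcm m n)
    ≤⟨ *-monoʳ (inv (lcm m n)) (0≤inv (lcm m n)) (ε≤3*inv m 3≤m) ⟩
  ι 3 * inv m * inv (lcm m n)
    ≡⟨ cong (ι 3 * inv m *_) inv-lcm ⟩
  ι 3 * inv m * (ι (gcd m n) * (inv m * inv n))
    ≡⟨ solve 4 (λ c m g n → c :* m :* (g :* (m :* n)) := c :* (n :* (g :* (m :* m)))) refl (ι 3) (inv m) (ι (gcd m n)) (inv n) ⟩
  ι 3 * (inv n * (ι (gcd m n) * inv² m)) ∎
  where
  open ℚ.≤-Reasoning
  instance
    gcd≢0 = ℕ.≢-nonZero (gcd[m,n]≢0 m n (inj₂ (ℕ.>⇒≢ (ℕ.≤-trans (s≤s z≤n) 3≤n))))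
  inv-lcm : inv (lcm m n) ≡ ι (gcd m n) * (inv m * inv n)
  inv-lcm = E.begin
    inv (lcm m n)                                  E.≡⟨ trans (cong (_* inv (lcm m n)) (ι*inv (gcd m n)))
                                                         (ℚ.*-identityˡ (inv (lcm m n))) ⟨
    (ι (gcd m n) * inv (gcd m n)) * inv (lcm m n)  E.≡⟨ ℚ.*-assoc (ι (gcd m n)) (inv (gcd m n)) (inv (lcm m n)) ⟩
    ι (gcd m n) * (inv (gcd m n) * inv (lcm m n))  E.≡⟨ cong (ι (gcd m n) *_) (trans (sym (inv-* (gcd m n) (lcm m n)))
                                                         (trans (cong inv (gcd*lcm m n)) (inv-* m n))) ⟩
    ι (gcd m n) * (inv m * inv n)                  E.∎
    where module E = ≡-Reasoning

recipSum≡ : ∀ a m → recipSum a m ≡ ∑[ range (suc a) m ] inv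
recipSum≡ a zero    = refl
recipSum≡ a (suc m) = cong (inv (suc a) +_) (recipSum≡ (suc a) m)

-- The left side is the right-endpoint sum with unit steps, and refining the steps of a decreasing
-- integrand raises such a sum. Hence the bound holds at every `k`, not only in the limit.
∑-inv≤logSum : ∀ N k → ∑[ range 2 (value N ℕ.∸ 1) ] inv ℚ.≤ logSum N k
∑-inv≤logSum N k = subst₂ ℚ._≤_ (recipSum≡ 1 (value N ℕ.∸ 1))
  (cong (λ z → recipSum z ((value N ℕ.∸ 1) ℕ.* suc k)) (ℕ.*-identityˡ (suc k)))
  (recipSum-refine-≥ 1 (value N ℕ.∸ 1) k)

-- 126 = 3·3·(2·3 + 4·2): the outer threes replace 1/(N-2) and 1/(m-2), the 2 and 4 come from
-- `∑-divisors-inv²`, and the inner 3 and 2 from `H≤3L` and `1≤2L`. The bound on the list, `M`, does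
-- not enter the result.
Q-bound : ∀ N k → 3 ≤ value N → ∀ {ns} → All (value N ≤_) ns → AllPairs ℕ._>_ ns → ∀ {M} → All (ℕ._< M) ns →
  inv (value N ℕ.∸ 2) * pairSum (λ m n → ε m * inv (lcm m n)) ns ℚ.≤ ι 126 * (logSum N k * inv² (value N))
Q-bound N@(mkℕ⁺ v@(suc x)) k 3≤v {ns} v≤ns dec {M} ns<M = begin
  inv (v ℕ.∸ 2) * pairSum (λ m n → ε m * inv (lcm m n)) ns
    ≤⟨ *-mono (0≤inv (v ℕ.∸ 2)) (0≤* (0≤ι 3) (0≤pairSum ns)) (ε≤3*inv v 3≤v)
         (ℚ.≤-trans (pairSum-mono v≤ns (λ {m} {n} v≤m v≤n → ε*inv-lcm≤ m n (ℕ.≤-trans 3≤v v≤m) (ℕ.≤-trans 3≤v v≤n)))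
           (ℚ.≤-reflexive (pairSum-*ˡ (ι 3) q ns))) ⟩
  ι 3 * inv v * (ι 3 * pairSum q ns)
    ≤⟨ *-monoˡ (ι 3 * inv v) (0≤* (0≤ι 3) (0≤inv v)) (*-monoˡ (ι 3) (0≤ι 3) pairSum≤) ⟩
  ι 3 * inv v * (ι 3 * (ι 2 * inv v * H + ι 4 * inv v))
    ≤⟨ *-monoˡ (ι 3 * inv v) (0≤* (0≤ι 3) (0≤inv v)) (*-monoˡ (ι 3) (0≤ι 3)
         (ℚ.+-mono-≤ (*-monoˡ (ι 2 * inv v) (0≤* (0≤ι 2) (0≤inv v)) H≤3L)
                     (*-monoʳ (inv v) (0≤inv v) (*-monoˡ (ι 4) (0≤ι 4) 1≤2L)))) ⟩
  ι 3 * inv v * (ι 3 * (ι 2 * inv v * (ι 3 * L) + ι 4 * (ι 2 * L) * inv v))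
    ≡⟨ solve 2 (λ i l → con (ι 3) :* i :* (con (ι 3) :* (con (ι 2) :* i :* (con (ι 3) :* l) :+ con (ι 4) :* (con (ι 2) :* l) :* i))
         := con (ι 126) :* (l :* (i :* i))) refl (inv v) L ⟩
  ι 126 * (L * inv² v) ∎
  where
  open ℚ.≤-Reasoning
  L = logSum N k
  H = ∑[ range 1 x ] inv
  q : ℕ → ℕ → ℚ
  q m n = inv n * (ι (gcd m n) * inv² m)
  0≤q : ∀ m n → 0ℚ ℚ.≤ q m n
  0≤q m n = 0≤* (0≤inv n) (0≤* (0≤ι (gcd m n)) (0≤inv² m))
  0≤pairSum : ∀ ns → 0ℚ ℚ.≤ pairSum q ns
  0≤pairSum []       = ℚ.≤-refl
  0≤pairSum (n ∷ ns) = 0≤+ (∑-nonNeg (0≤q n) ns) (0≤pairSum ns)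
  pairSum≤ : pairSum q ns ℚ.≤ ι 2 * inv v * H + ι 4 * inv v
  pairSum≤ = begin
    pairSum q ns
      ≤⟨ pairSum≤triangle 0≤q M v≤ns (All.map (λ n<M → ℕ.≤-trans n<M (ℕ.m≤n+m M v)) ns<M) dec ⟩
    triangle q v M
      -- This cut-off equals v + M, so it covers every index of the triangle, and it is written to
      -- split at `x` = N - 1.
      ≤⟨ triangle≤∑ q (λ l → inv l * (inv l * divisors (x ℕ.+ suc M) l)) (x ℕ.+ suc M) v M (s≤s z≤n)
           (ℕ.≤-reflexive (sym (ℕ.+-suc x M)))
           (λ l j 1≤l l≤G → ℚ.≤-trans (ℚ.≤-reflexive (∑-*ˡ (inv l) _ (range (suc l) j)))
             (*-monoˡ (inv l) (0≤inv l) (∑-gcd-inv² (x ℕ.+ suc M) l j 1≤l l≤G))) ⟩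
    ∑[ range v M ] (λ l → inv l * (inv l * divisors (x ℕ.+ suc M) l))
      ≤⟨ ∑-divisors-inv² x (suc M) M (ℕ.≤-trans (s≤s z≤n) (ℕ.≤-pred 3≤v)) ⟩
    ι 2 * inv v * H + ι 4 * inv v ∎
  -- The sum 1/2 + ... + 1/N contains 1/2; this lets log N absorb the constant term.
  1≤2L : 1ℚ ℚ.≤ ι 2 * L
  1≤2L = ℚ.≤-trans (ℚ.≤-reflexive (sym (ι*inv 2))) (*-monoˡ (ι 2) (0≤ι 2)
    (ℚ.≤-trans (term≤∑-range 0≤inv 2 x ℕ.≤-refl (ℕ.m≤n⇒m≤1+n 3≤v)) (∑-inv≤logSum N k)))
  H≤3L : H ℚ.≤ ι 3 * L
  H≤3L = begin
    H                                   ≤⟨ ∑-range-mono 0≤inv 1 (ℕ.n≤1+n x) ⟩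
    1ℚ + ∑[ range 2 x ] inv            ≤⟨ ℚ.+-mono-≤ 1≤2L (∑-inv≤logSum N k) ⟩
    ι 2 * L + L                         ≡⟨ solve 1 (λ l → con (ι 2) :* l :+ l := con (ι 3) :* l) refl L ⟩
    ι 3 * L                             ∎

-- Sorting the moduli, and the final estimate

∏-↭ : ∀ (f : ℕ → ℚ) {ms ns} → ms ↭ ns → ∏[ ms ] f ≡ ∏[ ns ] f
∏-↭ f ms↭ns = foldr-commMonoid (setoid ℚ) ℚ.*-1-isCommutativeMonoid (↭⇒↭ₛ (↭.map⁺ f ms↭ns))

-- The sort uses the flipped order and gives a weakly decreasing list; distinctness makes it strict.
sort-decreasing : ∀ {ns} → Unique ns → AllPairs ℕ._>_ (sort ns)
sort-decreasing {ns} unique = AllPairs.zipWith (λ (n≤m , m≢n) → ℕ.≤∧≢⇒< n≤m (m≢n ∘ sym))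
  ( Linked⇒AllPairs (λ m≥n n≥o → ℕ.≤-trans n≥o m≥n) (sort-↗ ns)
  , Unique-resp-↭ (setoid ℕ) (↭⇒↭ₛ (↭-sym (sort-↭ ns))) unique )

-- Stated for each approximation `logSum N k` of log N, so the inequality between reals follows
-- termwise, without using its slack.
variance-bound : ∀ T N k → Unique T → All (λ n → value N ≤ value n) T → 3 ≤ value N →
  average (λ C → ∣ δ C - α T ∣ ²) T ℚ.≤ ι 126 * (α T ² * logSum N k) * recip N ²
variance-bound T N k unique N≤T 3≤N = begin
  average (λ C → ∣ δ C - a ∣ ²) T
    ≡⟨ variance≡ T ⟩
  mean P (λ j → mean P (λ i → ∏[ T ] (avoid₂ i j))) - a * a
    -- The bound on the inner average is uniform in `j`, so the outer one becomes the average of a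
    -- constant.
    ≤⟨ ℚ.+-monoˡ-≤ (- (a * a)) (mean-mono P second-moment) ⟩
  mean P (λ _ → a * a + a * a * q) - a * a
    ≡⟨ cong (_- a * a) (mean-const P (a * a + a * a * q)) ⟩
  a * a + a * a * q - a * a
    ≡⟨ solve 2 (λ a q → a :+ a :* q :- a := a :* q) refl (a * a) q ⟩
  a * a * q
    ≤⟨ *-monoˡ (a * a) (p²-nonNeg a) (Q-bound N k 3≤N N≤ns decreasing ns<) ⟩
  a * a * (ι 126 * (logSum N k * inv² (value N)))
    ≡⟨ trans (solve 4 (λ s c l i → s :* (c :* (l :* i)) := c :* (s :* l) :* i) refl (a * a) (ι 126) (logSum N k) (inv² (value N)))
         (cong (λ z → ι 126 * (a * a * logSum N k) * (z * z)) (sym (recip≡inv N))) ⟩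
  ι 126 * (a ² * logSum N k) * recip N ² ∎
  where
  open ℚ.≤-Reasoning
  a = α T
  P = product (map value T)
  instance P≢0 = subst ℕ.NonZero (W≡product T) (W≢0 T)
  ns = sort (map value T)
  ns↭ : map value T ↭ ns
  ns↭ = ↭-sym (sort-↭ (map value T))
  decreasing : AllPairs ℕ._>_ ns
  decreasing = sort-decreasing (Unique.map⁺ value-injective unique)
  N≤ns : All (value N ≤_) ns
  N≤ns = ↭.All-resp-↭ ns↭ (All.map⁺ N≤T)
  ns∣P : All (ℕ._∣ P) ns
  ns∣P = ↭.All-resp-↭ ns↭ (All.tabulate ∈⇒∣product)
  -- Any strict upper bound serves; `suc P` is at hand because every modulus divides `P`.
  ns< : All (ℕ._< suc P) ns
  ns< = All.map (λ n∣P → s≤s (ℕ.∣⇒≤ n∣P)) ns∣P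
  q = inv (value N ℕ.∸ 2) * pairSum (λ m n → ε m * inv (lcm m n)) ns

  ∏-ns : ∀ f → ∏[ T ] (f ∘ value) ≡ ∏[ ns ] f
  ∏-ns f = trans (sym (∏-map f value T)) (∏-↭ f ns↭)
  a≡ : a ≡ ∏[ ns ] (λ n → 1ℚ - inv n)
  a≡ = trans (∏-cong (λ n → cong (λ z → 1ℚ - z) (recip≡inv n)) T) (∏-ns (λ n → 1ℚ - inv n))

  0≤avoid₂ : ∀ i j n → 0ℚ ℚ.≤ avoid₂ i j n
  0≤avoid₂ i j n = 0≤* (0≤inv (value n)) (∑-nonNeg (λ r → 0≤* (0≤miss j (n , r)) (0≤miss i (n , r))) (applyUpTo suc (value n)))
    where
    0≤miss : ∀ i c → 0ℚ ℚ.≤ miss i c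
    0≤miss i c = p≤q⇒0≤q-p (⟦⟧≤1 (ℤ.+ i ∈ᶜ? c))

  second-moment : ∀ j → mean P (λ i → ∏[ T ] (avoid₂ i j)) ℚ.≤ a * a + a * a * q
  second-moment j = begin
    mean P (λ i → ∏[ T ] (avoid₂ i j))
      ≤⟨ mean-mono P (λ i → ℚ.≤-trans
           (∏-mono (All.universal (0≤avoid₂ i j) T) (All.universal (avoid₂-≤ i j) T))
           (ℚ.≤-reflexive (∏-ns (λ n → (1ℚ - (inv n + inv n)) + inv n * divides P j n i)))) ⟩
    mean P (λ i → ∏[ ns ] (λ n → (1ℚ - (inv n + inv n)) + inv n * divides P j n i))
      ≤⟨ mean-∏≤a²+a²Q P j (value N) 3≤N N≤ns decreasing ns∣P ⟩
    _ ≡⟨ cong (λ z → z * z + z * z * q) (sym a≡) ⟩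
    a * a + a * a * q ∎

theorem7 : ∃ λ (A : ℝ) → 0ᴿ <ᴿ A ×
    (∀ (T : List ℕ⁺) (N : ℕ⁺) → Unique T → IsMinimum N T → 3 ≤ value N →
    fromℚ (average (λ C → ∣ δ C - α T ∣ ²) T)
    ≤ᴿ A *ᴿ (fromℚ (α T ²) *ᴿ log N) *ᴿ fromℚ (recip N ²))
theorem7 = fromℚ (ι 126) ,
  -- `ι 126` unfolds to `1ℚ + ι 125`, so 1 is a gap above zero.
  (1ℚ , ℚ.positive⁻¹ 1ℚ , 0 , λ _ _ → p≤p+q 1ℚ (0≤ι 125)) ,
  λ T N unique (_ , N≤T) 3≤N ε 0<ε → 0 , λ k _ →
    ℚ.≤-trans (variance-bound T N k unique N≤T 3≤N)
              (p≤p+q (ι 126 * (α T ² * logSum N k) * recip N ²) (ℚ.<⇒≤ 0<ε))
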